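{- Let $\pi(p),\sigma(p)$ be unary DLE-terms positive in $p$ and $\lambda(p),\rho(p)$ unary DLE-terms negative in $p$. Let $A$ be a DLE such that $$A\models \pi(p\vee q)\le \pi(p)\vee\pi(q),\qquad A\models \sigma(p)\wedge\sigma(q)\le\sigma(p\wedge q),$$ $$A\models \rho(p)\wedge\rho(q)\le\rho(p\vee q),\qquad A\models \lambda(p\wedge q)\le\lambda(p)\vee\lambda(q).$$ Let $\phi\le\psi$ be a DLE-inequality that is meta-inductive (with respect to $\pi,\sigma,\lambda,\rho$). Then $$A\models\phi\le\psi\ \Longrightarrow\ A^\delta\models\phi\le\psi .$$
   Context: **DLEs.** Fix disjoint sets $\mathcal F,\mathcal G$ of connectives; each $f\in\mathcal F$ (resp. $g\in\mathcal G$) has an arity $n_f$ (resp. $n_g$) and an order-type $\varepsilon_f\in\{1,\partial\}^{n_f}$ (resp. $\varepsilon_g\in\{1,\partial\}^{n_g}$). DLE-terms are built from propositional variables and $\bot,\top$ by $\wedge,\vee$ and the connectives in $\mathcal F\cup\mathcal G$. A DLE (normal distributive lattice expansion) is a bounded distributive lattice (BDL) $A$ with operations $f^A,g^A$ of the given arities such that, in each coordinate $i$: $f^A$ preserves finite (including empty) joins if $\varepsilon_f(i)=1$ and sends finite (including empty) meets to joins if $\varepsilon_f(i)=\partial$; $g^A$ preserves finite (including empty) meets if $\varepsilon_g(i)=1$ and sends finite (including empty) joins to meets if $\varepsilon_g(i)=\partial$. $A\models s\le t$ means that $s\le t$ holds in $A$ under every assignment of the variables to elements of $A$. A term is positive (negative)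 in $p$ if every occurrence of $p$ lies under an even (odd) number of argument places of order-type $\partial$ ($\wedge,\vee$ have order-type $1$ in both arguments). **Canonical extension.** The canonical extension of a BDL $A$ is the (unique up to isomorphism) complete BDL $A^\delta$ containing $A$ as a sublattice such that every element of $A^\delta$ is both a join of meets and a meet of joins of elements of $A$, and for all $S,T\subseteq A$ with $\bigwedge S\le\bigvee T$ in $A^\delta$ there are finite $F\subseteq S$, $G\subseteq T$ with $\bigwedge F\le\bigvee G$. $K(A^\delta)$ is the set of meets, $O(A^\delta)$ the set of joins, of subsets of $A$. For order-preserving $h:A\to B$ and $u\in A^\delta$, $h^\sigma(u)=\bigvee\{\bigwedge\{h(a): x\le a\in A\}: u\ge x\in K(A^\delta)\}$ and $h^\pi(u)=\bigwedge\{\bigvee\{h(a): y\ge a\in A\}: u\le y\in O(A^\delta)\}$. The canonical extension of a DLE $A$ is the lattice $A^\delta$ with operations $f^\sigma$ ($f\in\mathcal F$) and $g^\pi$ ($g\in\mathcal G$), where $f$ is regarded as an order-preserving map $A^{\varepsilon_f}\to A$ (similarly $g$), $A^\varepsilon$ being the product with $i$-th factor $A$ if $\varepsilon_i=1$ and the order-dual $A^\partial$ if $\varepsilon_i=\partial$, and $(A^{\varepsilon})^\delta$ is identified with $(A^\delta)^{\varepsilon}$. **The language DLE$^*$.** It is the language of the same kind over the signature $\mathcal F^*=\mathcal F\cup\{\dot\Diamond,\dot\lhd\}$, $\mathcal G^*=\mathcal G\cup\{\dot\Box,\dot\rhd\}$, where the four new connectives are unary, $\dot\Diamond,\dot\Box$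 of order-type $1$ and $\dot\lhd,\dot\rhd$ of order-type $\partial$. **Inductive DLE$^*$-inequalities.** The positive (negative) signed generation tree $+s$ ($-s$) of a term $s$ is its generation tree with root signed $+$ ($-$), where children of nodes $\wedge,\vee$ get the parent's sign and the $i$-th child of a node labelled by a connective gets the parent's sign if the order-type at $i$ is $1$ and the opposite sign if it is $\partial$. Signed nodes are classified as follows ($f\in\mathcal F^*$, $g\in\mathcal G^*$). Skeleton nodes: $\Delta$-adjoints $+\vee,+\wedge,-\wedge,-\vee$; SLR nodes $+\wedge$, $+f$ with $n_f\ge1$, $-\vee$, $-g$ with $n_g\ge 1$. PIA nodes: SRA nodes $+\wedge$, $+g$ with $n_g=1$, $-\vee$, $-f$ with $n_f=1$; SRR nodes $+\vee$, $+g$ with $n_g\ge2$, $-\wedge$, $-f$ with $n_f\ge2$. A branch is good if it is the concatenation of two paths $P_1,P_2$ (one possibly of length $0$), where $P_1$ starts from the leaf and consists, apart from variable nodes, only of PIA nodes, and $P_2$ consists, apart from variable nodes, only of Skeleton nodes. For an order-type $\varepsilon\in\{1,\partial\}^n$ on variables $p_1,\dots,p_n$, a leaf $+p_i$ with $\varepsilon_i=1$ or $-p_i$ with $\varepsilon_i=\partial$ is $\varepsilon$-critical; a branch from such a leaf is an $\varepsilon$-critical branch. $\varepsilon^\partial$ is the opposite order-type ($\varepsilon^\partial_i=1$ iff $\varepsilon_i=\partial$). For a subterm $\gamma$ of $*s$ ($*\in\{+,-\}$), $\varepsilon^\partial(\gamma)\prec *s$ means that, with the signs inherited from $*s$, all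 variable leaves of $\gamma$ are $\varepsilon^\partial$-critical. Given $\varepsilon$ and an irreflexive transitive relation $<_\Omega$ on $p_1,\dots,p_n$, the tree $*s$ is $(\Omega,\varepsilon)$-inductive if for each $1\le i\le n$ every $\varepsilon$-critical branch with leaf $p_i$ is good, and every $m$-ary SRR node occurring in that branch is of the form $\circledast(\gamma_1,\dots,\gamma_{j-1},\beta,\gamma_{j+1},\dots,\gamma_m)$ (with $\beta$ the argument the branch passes through) where for every $h\ne j$: $\varepsilon^\partial(\gamma_h)\prec *s$, and $p_k<_\Omega p_i$ for every $p_k$ occurring in $\gamma_h$. An inequality $s\le t$ is inductive if for some $\Omega,\varepsilon$ both $+s$ and $-t$ are $(\Omega,\varepsilon)$-inductive. **Meta-inductive inequalities.** Let $\Phi(\dot\Diamond)=\pi$, $\Phi(\dot\Box)=\sigma$, $\Phi(\dot\lhd)=\lambda$, $\Phi(\dot\rhd)=\rho$. A DLE-inequality $\phi\le\psi$ is meta-inductive if it is obtained from some inductive DLE$^*$-inequality $s\le t$ by replacing each occurrence of $\odot\in\{\dot\Diamond,\dot\Box,\dot\lhd,\dot\rhd\}$ with $\Phi(\odot)$, i.e. (recursively) each subterm $\odot\theta$ by $\Phi(\odot)(\theta)$. -}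

module Defs where

open import Level using (Level; 0ℓ; suc; _⊔_)
open import Data.Fin.Base using (Fin)
open import Data.Fin.Patterns using (0F; 1F)
open import Data.List.Base using (List; []; _∷_; _++_; foldr; map)
open import Data.List.Relation.Unary.All using (All)
open import Data.Nat.Base as ℕ using (ℕ; parity)
open import Data.Parity.Base using (0ℙ; 1ℙ)
open import Data.Product.Base using (Σ; Σ-syntax; ∃; ∃₂; _×_; _,_; proj₁)
open import Data.Sign.Base using (Sign; opposite) renaming (+ to ⊕; - to ⊖)
open import Data.Sum.Base using (_⊎_)
open import Data.Unit.Polymorphic.Base using () renaming (⊤ to Unit)
open import Data.Vec.Functional using (Vector; updateAt) renaming ([] to []ᵛ; _∷_ to _∷ᵛ_)
open import Function.Base using (flip; _∘_)
open import Relation.Binary.Core using (Rel; _Preserves_⟶_)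
open import Relation.Binary.Definitions using (Irreflexive; Transitive)
open import Relation.Binary.Lattice.Bundles using (BoundedLattice)
open import Relation.Binary.PropositionalEquality.Core using (_≡_; _≢_)
open import Relation.Unary using (Pred; _∈_; _⊆_)
import Algebra.Definitions as AlgebraDefinitions

data OrderType : Set where
  𝟙 ∂ : OrderType

flipᵒ : OrderType → OrderType
flipᵒ 𝟙 = ∂
flipᵒ ∂ = 𝟙

record Signature (o : Level) : Set (suc o) where
  field
    F G  : Set o
    ar-f : F → ℕ
    ar-g : G → ℕ
    ot-f : (f : F) → Vector OrderType (ar-f f)
    ot-g : (g : G) → Vector OrderType (ar-g g)

-- Labels of the inner nodes of generation trees.  Treating the lattice
-- connectives on a par with those of F and G makes subterms, branches and
-- signs uniform in the label.

data Label {o} (𝒮 : Signature o) : Set o where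
  ⊥̂ ⊤̂ ∧̂ ∨̂ : Label 𝒮
  𝕗        : Signature.F 𝒮 → Label 𝒮
  𝕘        : Signature.G 𝒮 → Label 𝒮

module _ {o} {𝒮 : Signature o} where
  open Signature 𝒮

  arity : Label 𝒮 → ℕ
  arity ⊥̂     = 0
  arity ⊤̂     = 0
  arity ∧̂     = 2
  arity ∨̂     = 2
  arity (𝕗 f) = ar-f f
  arity (𝕘 g) = ar-g g

  orderType : (c : Label 𝒮) → Vector OrderType (arity c)
  orderType ∧̂     _ = 𝟙
  orderType ∨̂     _ = 𝟙
  orderType (𝕗 f) i = ot-f f i
  orderType (𝕘 g) i = ot-g g i

data Term {o} (𝒮 : Signature o) (n : ℕ) : Set o where
  var  : Fin n → Term 𝒮 n
  node : (c : Label 𝒮) → (Fin (arity c) → Term 𝒮 n) → Term 𝒮 n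

module _ {o} {𝒮 : Signature o} {n : ℕ} where

  infixr 7 _∧ᵗ_
  infixr 6 _∨ᵗ_

  _∧ᵗ_ _∨ᵗ_ : Term 𝒮 n → Term 𝒮 n → Term 𝒮 n
  s ∧ᵗ t = node ∧̂ (s ∷ᵛ t ∷ᵛ []ᵛ)
  s ∨ᵗ t = node ∨̂ (s ∷ᵛ t ∷ᵛ []ᵛ)

  infix 8 _[_]

  _[_] : Term 𝒮 1 → Term 𝒮 n → Term 𝒮 n
  var _       [ θ ] = θ
  node c args [ θ ] = node c (λ i → args i [ θ ])

-- Branch x s: the branches of the generation tree of s ending in a leaf
-- labelled x, i.e. the occurrences of x in s.

data Branch {o} {𝒮 : Signature o} {n : ℕ} (x : Fin n) : Term 𝒮 n → Set o where
  leaf : Branch x (var x)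
  step : ∀ {c args} (j : Fin (arity c)) → Branch x (args j) → Branch x (node c args)

module _ {o} {𝒮 : Signature o} {n : ℕ} {x : Fin n} where

  ∂-places : {s : Term 𝒮 n} → Branch x s → ℕ
  ∂-places leaf             = 0
  ∂-places (step {c = c} j b) with orderType c j
  ... | 𝟙 = ∂-places b
  ... | ∂ = ℕ.suc (∂-places b)

module _ {o} {𝒮 : Signature o} {n : ℕ} where

  PositiveIn NegativeIn : Fin n → Term 𝒮 n → Set o
  PositiveIn x s = (b : Branch x s) → parity (∂-places b) ≡ 0ℙ
  NegativeIn x s = (b : Branch x s) → parity (∂-places b) ≡ 1ℙ

module _ {o} {𝒮 : Signature o} where
  open Signature 𝒮

  actᵒ : OrderType → Sign → Sign
  actᵒ 𝟙 ∗ = ∗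
  actᵒ ∂ ∗ = opposite ∗

  childSign : Sign → (c : Label 𝒮) → Fin (arity c) → Sign
  childSign ∗ c i = actᵒ (orderType c i) ∗

  data ΔAdjoint : Sign → Label 𝒮 → Set o where
    +∨ : ΔAdjoint ⊕ ∨̂
    +∧ : ΔAdjoint ⊕ ∧̂
    -∧ : ΔAdjoint ⊖ ∧̂
    -∨ : ΔAdjoint ⊖ ∨̂

  data SLR : Sign → Label 𝒮 → Set o where
    +∧ : SLR ⊕ ∧̂
    +f : ∀ {f} → 1 ℕ.≤ ar-f f → SLR ⊕ (𝕗 f)
    -∨ : SLR ⊖ ∨̂
    -g : ∀ {g} → 1 ℕ.≤ ar-g g → SLR ⊖ (𝕘 g)

  data SRA : Sign → Label 𝒮 → Set o where
    +∧ : SRA ⊕ ∧̂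
    +g : ∀ {g} → ar-g g ≡ 1 → SRA ⊕ (𝕘 g)
    -∨ : SRA ⊖ ∨̂
    -f : ∀ {f} → ar-f f ≡ 1 → SRA ⊖ (𝕗 f)

  data SRR : Sign → Label 𝒮 → Set o where
    +∨ : SRR ⊕ ∨̂
    +g : ∀ {g} → 2 ℕ.≤ ar-g g → SRR ⊕ (𝕘 g)
    -∧ : SRR ⊖ ∧̂
    -f : ∀ {f} → 2 ℕ.≤ ar-f f → SRR ⊖ (𝕗 f)

  SkeletonNode PIANode : Sign × Label 𝒮 → Set o
  SkeletonNode (∗ , c) = ΔAdjoint ∗ c ⊎ SLR ∗ c
  PIANode      (∗ , c) = SRA ∗ c ⊎ SRR ∗ c

  module _ {n : ℕ} where

    -- The signed inner nodes of a branch of the tree ∗s, from the root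
    -- towards the leaf.
    nodes : Sign → {s : Term 𝒮 n} {x : Fin n} → Branch x s → List (Sign × Label 𝒮)
    nodes ∗ leaf               = []
    nodes ∗ (step {c = c} j b) = (∗ , c) ∷ nodes (childSign ∗ c j) b

    leafSign : Sign → {s : Term 𝒮 n} {x : Fin n} → Branch x s → Sign
    leafSign ∗ leaf               = ∗
    leafSign ∗ (step {c = c} j b) = leafSign (childSign ∗ c j) b

    Good : Sign → {s : Term 𝒮 n} {x : Fin n} → Branch x s → Set o
    Good ∗ b = ∃₂ λ P₂ P₁ → nodes ∗ b ≡ P₂ ++ P₁ × All SkeletonNode P₂ × All PIANode P₁

    data Critical (ε : Vector OrderType n) : Sign → Fin n → Set where
      +crit : ∀ {x} → ε x ≡ 𝟙 → Critical ε ⊕ x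
      -crit : ∀ {x} → ε x ≡ ∂ → Critical ε ⊖ x

    -- For a subterm γ which carries the sign ∗ in the ambient signed tree:
    -- all its variable leaves are ε-critical.
    AllCritical : Vector OrderType n → Sign → Term 𝒮 n → Set o
    AllCritical ε ∗ γ = ∀ {x} (b : Branch x γ) → Critical ε (leafSign ∗ b) x

    -- Every node of the branch that is classified as SRR is constrained,
    -- whichever part of the branch it lies on: +∨ and -∧ are SRR nodes also
    -- where they are used as Skeleton nodes.
    SRRCondition : Rel (Fin n) 0ℓ → Vector OrderType n →
                   Sign → {s : Term 𝒮 n} {x : Fin n} → Branch x s → Set o
    SRRCondition _<Ω_ ε ∗         leaf             = Unit
    SRRCondition _<Ω_ ε ∗ {x = x} (step {c} {γ} j b) =
      (SRR ∗ c → ∀ h → h ≢ j →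
         AllCritical (flipᵒ ∘ ε) (childSign ∗ c h) (γ h) ×
         (∀ k → Branch k (γ h) → k <Ω x)) ×
      SRRCondition _<Ω_ ε (childSign ∗ c j) b

    InductiveTree : Rel (Fin n) 0ℓ → Vector OrderType n → Sign → Term 𝒮 n → Set o
    InductiveTree _<Ω_ ε ∗ s =
      ∀ {x} (b : Branch x s) → Critical ε (leafSign ∗ b) x →
      Good ∗ b × SRRCondition _<Ω_ ε ∗ b

    Inductive : Term 𝒮 n → Term 𝒮 n → Set (suc 0ℓ ⊔ o)
    Inductive s t =
      Σ[ Ω ∈ Rel (Fin n) 0ℓ ] Σ[ ε ∈ Vector OrderType n ]
        Irreflexive _≡_ Ω × Transitive Ω ×
        InductiveTree Ω ε ⊕ s × InductiveTree Ω ε ⊖ t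

data F⋆ {o} (F : Set o) : Set o where
  old   : F → F⋆ F
  ◇̇ ⊲̇ : F⋆ F

data G⋆ {o} (G : Set o) : Set o where
  old   : G → G⋆ G
  □̇ ⊳̇ : G⋆ G

infix 9 _⋆

_⋆ : ∀ {o} → Signature o → Signature o
𝒮 ⋆ = record
  { F = F⋆ F ; G = G⋆ G ; ar-f = ar-f⋆ ; ar-g = ar-g⋆ ; ot-f = ot-f⋆ ; ot-g = ot-g⋆ }
  where
  open Signature 𝒮

  ar-f⋆ : F⋆ F → ℕ
  ar-f⋆ (old f) = ar-f f
  ar-f⋆ ◇̇      = 1
  ar-f⋆ ⊲̇      = 1

  ar-g⋆ : G⋆ G → ℕ
  ar-g⋆ (old g) = ar-g g
  ar-g⋆ □̇      = 1
  ar-g⋆ ⊳̇      = 1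

  ot-f⋆ : (f : F⋆ F) → Vector OrderType (ar-f⋆ f)
  ot-f⋆ (old f) = ot-f f
  ot-f⋆ ◇̇     _ = 𝟙
  ot-f⋆ ⊲̇     _ = ∂

  ot-g⋆ : (g : G⋆ G) → Vector OrderType (ar-g⋆ g)
  ot-g⋆ (old g) = ot-g g
  ot-g⋆ □̇     _ = 𝟙
  ot-g⋆ ⊳̇     _ = ∂

module _ {o} {𝒮 : Signature o} (π σ lam ρ : Term 𝒮 1) where

  replace : ∀ {n} → Term (𝒮 ⋆) n → Term 𝒮 n
  replace (var x)                = var x
  replace (node ⊥̂ args)         = node ⊥̂ (λ i → replace (args i))
  replace (node ⊤̂ args)         = node ⊤̂ (λ i → replace (args i))
  replace (node ∧̂ args)         = node ∧̂ (λ i → replace (args i))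
  replace (node ∨̂ args)         = node ∨̂ (λ i → replace (args i))
  replace (node (𝕗 (old f)) args)= node (𝕗 f) (λ i → replace (args i))
  replace (node (𝕘 (old g)) args)= node (𝕘 g) (λ i → replace (args i))
  replace (node (𝕗 ◇̇) args)     = π [ replace (args 0F) ]
  replace (node (𝕘 □̇) args)     = σ [ replace (args 0F) ]
  replace (node (𝕗 ⊲̇) args)     = lam [ replace (args 0F) ]
  replace (node (𝕘 ⊳̇) args)     = ρ [ replace (args 0F) ]

  data MetaInductive {n : ℕ} : Term 𝒮 n → Term 𝒮 n → Set (suc 0ℓ ⊔ o) where
    meta : ∀ {s t} → Inductive s t → MetaInductive (replace s) (replace t)

record BDL (ℓ : Level) : Set (suc ℓ) where
  field
    boundedLattice : BoundedLattice ℓ ℓ ℓ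

  open BoundedLattice boundedLattice public

  field
    ∧-distribˡ-∨ : AlgebraDefinitions._DistributesOverˡ_ _≈_ _∧_ _∨_

  ⋁ᶠ ⋀ᶠ : List Carrier → Carrier
  ⋁ᶠ = foldr _∨_ ⊥
  ⋀ᶠ = foldr _∧_ ⊤

-- Normality is left to DLE, so that the canonical extension can be defined as
-- an Algebra without first proving its operations normal.

record Algebra {o} (𝒮 : Signature o) (ℓ : Level) : Set (o ⊔ suc ℓ) where
  open Signature 𝒮
  field
    bdl : BDL ℓ

  open BDL bdl public

  field
    ⟦𝕗⟧ : (f : F) → Vector Carrier (ar-f f) → Carrier
    ⟦𝕘⟧ : (g : G) → Vector Carrier (ar-g g) → Carrier

  ⟦_⟧ : ∀ {n} → Term 𝒮 n → Vector Carrier n → Carrier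
  ⟦ var x ⟧           v = v x
  ⟦ node ⊥̂ _ ⟧        v = ⊥
  ⟦ node ⊤̂ _ ⟧        v = ⊤
  ⟦ node ∧̂ args ⟧     v = ⟦ args 0F ⟧ v ∧ ⟦ args 1F ⟧ v
  ⟦ node ∨̂ args ⟧     v = ⟦ args 0F ⟧ v ∨ ⟦ args 1F ⟧ v
  ⟦ node (𝕗 f) args ⟧ v = ⟦𝕗⟧ f (λ i → ⟦ args i ⟧ v)
  ⟦ node (𝕘 g) args ⟧ v = ⟦𝕘⟧ g (λ i → ⟦ args i ⟧ v)

infix 4 _⊨_≼_

_⊨_≼_ : ∀ {o ℓ n} {𝒮 : Signature o} → Algebra 𝒮 ℓ → Term 𝒮 n → Term 𝒮 n → Set ℓ
A ⊨ s ≼ t = ∀ v → ⟦ s ⟧ v ≤ ⟦ t ⟧ v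
  where open Algebra A

module _ {ℓ} (L : BDL ℓ) where
  open BDL L

  JoinNormal MeetNormal : OrderType → (Carrier → Carrier) → Set ℓ
  JoinNormal 𝟙 h = ∀ xs → h (⋁ᶠ xs) ≈ ⋁ᶠ (map h xs)
  JoinNormal ∂ h = ∀ xs → h (⋀ᶠ xs) ≈ ⋁ᶠ (map h xs)
  MeetNormal 𝟙 h = ∀ xs → h (⋀ᶠ xs) ≈ ⋀ᶠ (map h xs)
  MeetNormal ∂ h = ∀ xs → h (⋁ᶠ xs) ≈ ⋀ᶠ (map h xs)

  InCoordinate : ∀ {n} → (Vector Carrier n → Carrier) → Vector Carrier n → Fin n →
                 Carrier → Carrier
  InCoordinate h xs i x = h (updateAt xs i (λ _ → x))

record DLE {o} (𝒮 : Signature o) (ℓ : Level) : Set (o ⊔ suc ℓ) where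
  open Signature 𝒮
  field
    algebra : Algebra 𝒮 ℓ

  open Algebra algebra public

  field
    𝕗-cong   : ∀ f {xs ys} → (∀ i → xs i ≈ ys i) → ⟦𝕗⟧ f xs ≈ ⟦𝕗⟧ f ys
    𝕘-cong   : ∀ g {xs ys} → (∀ i → xs i ≈ ys i) → ⟦𝕘⟧ g xs ≈ ⟦𝕘⟧ g ys
    𝕗-normal : ∀ f xs i → JoinNormal bdl (ot-f f i) (InCoordinate bdl (⟦𝕗⟧ f) xs i)
    𝕘-normal : ∀ g xs i → MeetNormal bdl (ot-g g i) (InCoordinate bdl (⟦𝕘⟧ g) xs i)

module _ {i c ℓ} {I : Set i} {C : Set c} (_≤_ : Rel C ℓ) (φ : I → C) (x : C) where

  IsInf IsSup : Set (i ⊔ c ⊔ ℓ)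
  IsInf = (∀ i → x ≤ φ i) × (∀ y → (∀ i → y ≤ φ i) → y ≤ x)
  IsSup = (∀ i → φ i ≤ x) × (∀ y → (∀ i → φ i ≤ y) → x ≤ y)

-- Joins and meets are required for families one level up because K and O,
-- being defined by quantification over subsets, live there.

record CompleteBDL (ℓ : Level) : Set (suc (suc ℓ)) where
  field
    bdl : BDL ℓ

  open BDL bdl public

  field
    ⋁     : {I : Set (suc ℓ)} → (I → Carrier) → Carrier
    ⋀     : {I : Set (suc ℓ)} → (I → Carrier) → Carrier
    ⋁-sup : {I : Set (suc ℓ)} (φ : I → Carrier) → IsSup _≤_ φ (⋁ φ)
    ⋀-inf : {I : Set (suc ℓ)} (φ : I → Carrier) → IsInf _≤_ φ (⋀ φ)

-- A is a subset, via ι, of the ordered set (C , ≤).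

module Extension {ℓ} {A C : Set ℓ} (_≤_ : Rel C ℓ) (ι : A → C) where

  members : Pred A ℓ → Set ℓ
  members S = ∃ λ a → a ∈ S

  ι∣ : (S : Pred A ℓ) → members S → C
  ι∣ S (a , _) = ι a

  K O : Pred C (suc ℓ)
  K x = Σ[ S ∈ Pred A ℓ ] IsInf _≤_ (ι∣ S) x
  O y = Σ[ T ∈ Pred A ℓ ] IsSup _≤_ (ι∣ T) y

  -- The extensions of a map h from A to the elements of a complete lattice D
  -- (for a map A → B: its composite with the inclusion of B in D).
  module _ (D : CompleteBDL ℓ) (h : A → CompleteBDL.Carrier D) where
    private module D = CompleteBDL D

    σ-extension π-extension : C → D.Carrier
    σ-extension u = D.⋁ {I = ∃₂ λ x z → K x × x ≤ u ×
                               IsInf D._≤_ (λ ((a , _) : ∃ λ a → x ≤ ι a) → h a) z}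
                        (λ (_ , z , _) → z)
    π-extension u = D.⋀ {I = ∃₂ λ y z → O y × u ≤ y ×
                               IsSup D._≤_ (λ ((a , _) : ∃ λ a → ι a ≤ y) → h a) z}
                        (λ (_ , z , _) → z)

record CanonicalExtension {ℓ} (L : BDL ℓ) : Set (suc (suc ℓ)) where
  private module L = BDL L

  field
    completeBDL : CompleteBDL ℓ

  open CompleteBDL completeBDL public

  field
    ι           : L.Carrier → Carrier
    ι-cong      : ι Preserves L._≈_ ⟶ _≈_
    ι-injective : ∀ {a b} → ι a ≈ ι b → a L.≈ b
    ι-∨         : ∀ a b → ι (a L.∨ b) ≈ ι a ∨ ι b
    ι-∧         : ∀ a b → ι (a L.∧ b) ≈ ι a ∧ ι b
    ι-⊥         : ι L.⊥ ≈ ⊥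
    ι-⊤         : ι L.⊤ ≈ ⊤

  open Extension _≤_ ι public using (ι∣; K; O)

  field
    join-of-meets : ∀ u → Σ[ P ∈ Pred Carrier (suc ℓ) ]
                      P ⊆ K × IsSup _≤_ (λ ((x , _) : ∃ P) → x) u
    meet-of-joins : ∀ u → Σ[ P ∈ Pred Carrier (suc ℓ) ]
                      P ⊆ O × IsInf _≤_ (λ ((y , _) : ∃ P) → y) u
    compact       : ∀ (S T : Pred L.Carrier ℓ) {x y} →
                    IsInf _≤_ (ι∣ S) x → IsSup _≤_ (ι∣ T) y → x ≤ y →
                    ∃₂ λ Fs Gs → All S Fs × All T Gs × L.⋀ᶠ Fs L.≤ L.⋁ᶠ Gs

-- The order of the product whose i-th factor is C if ε i is 𝟙 and its
-- order-dual if ε i is ∂.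

Product≤ : ∀ {ℓ n} {C : Set ℓ} → Rel C ℓ → Vector OrderType n → Rel (Vector C n) ℓ
Product≤ _≤_ ε x y = ∀ i → along (ε i) (x i) (y i)
  where
  along : OrderType → Rel _ _
  along 𝟙 = _≤_
  along ∂ = flip _≤_

module _ {o ℓ} {𝒮 : Signature o} (A : DLE 𝒮 ℓ) (E : CanonicalExtension (DLE.bdl A)) where
  open Signature 𝒮
  private
    module A = DLE A
    module E = CanonicalExtension E

  canonicalExtension : Algebra 𝒮 ℓ
  canonicalExtension = record
    { bdl = E.bdl
    ; ⟦𝕗⟧ = λ f → Extension.σ-extension (Product≤ E._≤_ (ot-f f)) (E.ι ∘_)
                    E.completeBDL (E.ι ∘ A.⟦𝕗⟧ f)
    ; ⟦𝕘⟧ = λ g → Extension.π-extension (Product≤ E._≤_ (ot-g g)) (E.ι ∘_)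
                    E.completeBDL (E.ι ∘ A.⟦𝕘⟧ g)
    }

{-# OPTIONS --safe #-}

-- Skeleton operations preserve nonempty joins of Aδ in each coordinate (meets
-- at negative nodes), so for inductive s ≤ t and u in Aδ the value s(u) is a
-- join of elements κ determined by finitely many inequalities k ≤ γ(u) with γ
-- PIA and k closed, in the sense that each tuple a of A with k ≤ γ(a) for all
-- of them has κ ≤ s(a); dually for t.  Hence it is enough to find, for finitely
-- many PIA inequalities that hold at u, a tuple of A at which they hold.
-- Evaluate critical leaves by b and the others by c.  Compactness gives chains
-- e₀ ⊵ e₁ ⊵ … in A, of any length and for the order given by ε, such that the
-- inequalities hold for b = eₘ and c = eₘ₊₁; as PIA terms preserve binary meets
-- in the critical leaves, a diagonal tuple chosen along Ω solves them.
--
-- The terms π, σ, λ, ρ enter through their evaluation in Aδ.  On A they are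
-- only assumed to preserve (or reverse) binary joins or meets, not ⊥ or ⊤, so
-- only nonempty joins and meets are used throughout.
module Submission where

open import Defs
open import Level using (Lift; lift; 0ℓ; _⊔_) renaming (suc to lsuc)
open import Data.Empty using (⊥-elim)
open import Data.Fin.Base using (Fin; zero; suc)
open import Data.Fin.Patterns using (0F; 1F)
open import Data.Fin.Properties using (_≟_; any?)
open import Data.Fin.Induction using (spo-noetherian)
open import Data.List.Base using (List; []; _∷_; _++_; allFin)
open import Data.List.Membership.Propositional using () renaming (_∈_ to _∈ₗ_)
open import Data.List.Membership.Propositional.Properties using (∈-allFin)
open import Data.List.Relation.Unary.All using (All; []; _∷_)
open import Data.List.Relation.Unary.Any using (here; there)
open import Data.Nat.Base as ℕ using (ℕ)
import Data.Nat.Properties as ℕₚ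
open import Data.Parity.Base using (Parity; 0ℙ; 1ℙ; _⁻¹)
open import Data.Product.Base using (∃; ∃₂; _×_; _,_; proj₁; proj₂)
open import Data.Sign.Base using (Sign; opposite) renaming (+ to ⊕; - to ⊖)
open import Data.Sum.Base using (_⊎_; inj₁; inj₂)
open import Data.Unit.Polymorphic.Base using () renaming (⊤ to Unit)
open import Data.Vec.Functional using (Vector; updateAt) renaming ([] to []ᵛ; _∷_ to _∷ᵛ_)
open import Data.Vec.Functional.Properties using (updateAt-updates; updateAt-minimal)
open import Function.Base using (_∘_; const; flip)
open import Induction.WellFounded using (Acc; acc)
open import Relation.Binary.Core using (Rel)
open import Relation.Binary.Definitions using (Irreflexive; Transitive)
open import Relation.Binary.Structures using (IsStrictPartialOrder)
open import Relation.Binary.PropositionalEquality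
  using (_≡_; _≢_; refl; sym; trans; cong; subst; subst₂; isEquivalence)
open import Relation.Nullary using (¬_; Dec; yes; no)
open import Relation.Nullary.Decidable
  using (map′; _×-dec_; _⊎-dec_; ¬?; T?; True; toWitness; fromWitness)
open import Relation.Unary using (Pred)
import Relation.Binary.Lattice.Properties.DistributiveLattice as DistributiveLatticeProperties
open import Relation.Binary.Lattice.Bundles using (DistributiveLattice)

-- A map that misses the empty join has no residual on `Aδ`, so variables cannot be eliminated by
-- adjunction; solutions are sought among the tuples of `A` instead. A PIA inequality is helped by
-- raising critical values and lowering the others, yet a solution has to serve in both roles at
-- once. The descending chain resolves this conflict: `Sat eₘ eₘ₊₁` leaves a gap between the roles.
-- If `x` takes its value from `eₘ`, then a variable in a side argument next to a critical leaf `x`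
-- starts a longer chain of dependencies, and takes its value from `eₘ₊₁` or further down. One
-- inequality may have critical leaves of several levels; preservation of binary meets combines its
-- instances for all these levels. Dependencies lie in the strict order `Ω` on finitely many
-- variables, so their chains have bounded length.
--
-- Statements are made for an arbitrary sign, since a term mixes both and the dual of a statement is
-- then another instance of it.

orient : ∀ {a r} {X : Set a} → Rel X r → Sign → Rel X r
orient R ⊕ = R
orient R ⊖ = flip R

-- Wrapping the oriented order in a record makes the sign inferable.
record Oriented {a r} {X : Set a} (R : Rel X r) (s : Sign) (x y : X) : Set r where
  constructor ⟪_⟫
  field le : orient R s x y

open Oriented

act : OrderType → Sign → Sign
act 𝟙 s = s
act ∂ s = opposite s

act-opposite : ∀ e s → act e (opposite s) ≡ opposite (act e s)
act-opposite 𝟙 s = refl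
act-opposite ∂ s = refl

compareSign : ∀ s r → s ≡ r ⊎ s ≡ opposite r
compareSign ⊕ ⊕ = inj₁ refl
compareSign ⊖ ⊖ = inj₁ refl
compareSign ⊕ ⊖ = inj₂ refl
compareSign ⊖ ⊕ = inj₂ refl

module _ {a r} {X : Set a} {R : Rel X r} where

  turn : ∀ s {x y} → Oriented R s x y → Oriented R (opposite s) y x
  turn ⊕ ⟪ p ⟫ = ⟪ p ⟫
  turn ⊖ ⟪ p ⟫ = ⟪ p ⟫

  unturn : ∀ s {x y} → Oriented R (opposite s) x y → Oriented R s y x
  unturn ⊕ ⟪ p ⟫ = ⟪ p ⟫
  unturn ⊖ ⟪ p ⟫ = ⟪ p ⟫

-- Tuples changed at one coordinate, and bounds of finite families

replaceAt : ∀ {a n} {X : Set a} → Vector X n → Fin n → X → Vector X n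
replaceAt v j x = updateAt v j (const x)

replaceAt-elim : ∀ {a p n} {X : Set a} (P : Fin n → X → Set p) {v : Vector X n} {j x} →
                 P j x → (∀ h → h ≢ j → P h (v h)) → ∀ h → P h (replaceAt v j x h)
replaceAt-elim P {v} {j} pj p h with h ≟ j
... | yes refl = subst (P h) (sym (updateAt-updates h v)) pj
... | no h≢j   = subst (P h) (sym (updateAt-minimal h j v h≢j)) (p h h≢j)

replaceAt-elim₂ : ∀ {a p n} {X : Set a} (R : Fin n → X → X → Set p) {v w : Vector X n} {j x y} →
                  R j x y → (∀ h → h ≢ j → R h (v h) (w h)) →
                  ∀ h → R h (replaceAt v j x h) (replaceAt w j y h)
replaceAt-elim₂ R {v} {w} {j} r rs h with h ≟ j
... | yes refl = subst₂ (R h) (sym (updateAt-updates h v)) (sym (updateAt-updates h w)) r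
... | no h≢j   = subst₂ (R h) (sym (updateAt-minimal h j v h≢j))
                              (sym (updateAt-minimal h j w h≢j)) (rs h h≢j)

-- Coordinates pass from `Old` to `New` one at a time, which reduces a claim about whole tuples to a
-- change at a single `j`. The list in `go` holds the coordinates still allowed to be old.
coordinate-induction : ∀ {a p q r n} {X : Set a} (P : Vector X n → Set p)
  (Old : Fin n → X → Set q) (New : Fin n → X → Set r) →
  (∀ j w → Old j (w j) → (∀ x → New j x → P (replaceAt w j x)) → P w) →
  (∀ w → (∀ h → New h (w h)) → P w) →
  ∀ v → (∀ h → Old h (v h)) → P v
coordinate-induction {n = n} {X} P Old New change base v olds =
  go (allFin n) v λ h → inj₁ (∈-allFin h , olds h)
  where
  Status : List (Fin n) → Fin n → X → Set _
  Status hs h x = (h ∈ₗ hs × Old h x) ⊎ New h x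
  shrink : ∀ {j hs h x} → h ≢ j → Status (j ∷ hs) h x → Status hs h x
  shrink h≢j (inj₁ (here eq , _))  = ⊥-elim (h≢j eq)
  shrink h≢j (inj₁ (there h∈ , o)) = inj₁ (h∈ , o)
  shrink h≢j (inj₂ p)              = inj₂ p
  go : ∀ hs w → (∀ h → Status hs h (w h)) → P w
  go [] w status = base w λ h → finished (status h)
    where
    finished : ∀ {h x} → Status [] h x → New h x
    finished (inj₁ (() , _))
    finished (inj₂ p) = p
  go (j ∷ hs) w status with status j
  ... | inj₁ (_ , o) = change j w o λ x new →
    go hs (replaceAt w j x) (replaceAt-elim (Status hs) (inj₂ new) λ h h≢j → shrink h≢j (status h))
  ... | inj₂ p = go hs w rest
    where
    rest : ∀ h → Status hs h (w h)
    rest h with h ≟ j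
    ... | yes refl = inj₂ p
    ... | no h≢j   = shrink h≢j (status h)

finite-upper-bound : ∀ {a r} {I : Set a} (_≼_ : Rel I r) →
                     (∀ {i j k} → i ≼ j → j ≼ k → i ≼ k) → I →
                     (∀ i j → ∃ λ k → i ≼ k × j ≼ k) →
                     ∀ {m} (f : Fin m → I) → ∃ λ k → ∀ h → f h ≼ k
finite-upper-bound _≼_ ≼-trans i₀ ub {ℕ.zero}  f = i₀ , λ ()
finite-upper-bound _≼_ ≼-trans i₀ ub {ℕ.suc m} f =
  let k , f≼k        = finite-upper-bound _≼_ ≼-trans i₀ ub (f ∘ suc)
      l , f0≼l , k≼l = ub (f zero) k
  in l , λ { zero → f0≼l ; (suc h) → ≼-trans (f≼k h) k≼l }

-- Orders and lattices relative to a sign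

module OrientedLattice {ℓ} (L : BDL ℓ) where
  open BDL L hiding (refl; trans)

  infix 4 _≤⟨_⟩_

  _≤⟨_⟩_ : Carrier → Sign → Carrier → Set ℓ
  x ≤⟨ s ⟩ y = Oriented _≤_ s x y

  ≤⟨⟩-refl : ∀ s {x} → x ≤⟨ s ⟩ x
  ≤⟨⟩-refl ⊕ = ⟪ BDL.refl L ⟫
  ≤⟨⟩-refl ⊖ = ⟪ BDL.refl L ⟫

  ≤⟨⟩-trans : ∀ {s x y z} → x ≤⟨ s ⟩ y → y ≤⟨ s ⟩ z → x ≤⟨ s ⟩ z
  ≤⟨⟩-trans {⊕} ⟪ p ⟫ ⟪ q ⟫ = ⟪ BDL.trans L p q ⟫
  ≤⟨⟩-trans {⊖} ⟪ p ⟫ ⟪ q ⟫ = ⟪ BDL.trans L q p ⟫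

  ≤⟨⟩-reflexive : ∀ s {x y} → x ≡ y → x ≤⟨ s ⟩ y
  ≤⟨⟩-reflexive s refl = ≤⟨⟩-refl s

  ≈⇒≤⟨⟩ : ∀ s {x y} → x ≈ y → x ≤⟨ s ⟩ y
  ≈⇒≤⟨⟩ ⊕ p = ⟪ reflexive p ⟫
  ≈⇒≤⟨⟩ ⊖ p = ⟪ reflexive (Eq.sym p) ⟫

  ≤⟨⟩-antisym : ∀ s {x y} → x ≤⟨ s ⟩ y → y ≤⟨ s ⟩ x → x ≈ y
  ≤⟨⟩-antisym ⊕ ⟪ p ⟫ ⟪ q ⟫ = antisym p q
  ≤⟨⟩-antisym ⊖ ⟪ p ⟫ ⟪ q ⟫ = antisym q p

  join meet : Sign → Carrier → Carrier → Carrier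
  join ⊕ = _∨_
  join ⊖ = _∧_
  meet s = join (opposite s)

  bot : Sign → Carrier
  bot ⊕ = ⊥
  bot ⊖ = ⊤

  join-ub₁ : ∀ s {x y} → x ≤⟨ s ⟩ join s x y
  join-ub₁ ⊕ = ⟪ x≤x∨y _ _ ⟫
  join-ub₁ ⊖ = ⟪ x∧y≤x _ _ ⟫

  join-ub₂ : ∀ s {x y} → y ≤⟨ s ⟩ join s x y
  join-ub₂ ⊕ = ⟪ y≤x∨y _ _ ⟫
  join-ub₂ ⊖ = ⟪ x∧y≤y _ _ ⟫

  join-least : ∀ s {x y z} → x ≤⟨ s ⟩ z → y ≤⟨ s ⟩ z → join s x y ≤⟨ s ⟩ z
  join-least ⊕ ⟪ p ⟫ ⟪ q ⟫ = ⟪ ∨-least p q ⟫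
  join-least ⊖ ⟪ p ⟫ ⟪ q ⟫ = ⟪ ∧-greatest p q ⟫

  meet-lb₁ : ∀ s {x y} → meet s x y ≤⟨ s ⟩ x
  meet-lb₁ s = unturn s (join-ub₁ (opposite s))

  meet-lb₂ : ∀ s {x y} → meet s x y ≤⟨ s ⟩ y
  meet-lb₂ s = unturn s (join-ub₂ (opposite s))

  meet-greatest : ∀ s {x y z} → z ≤⟨ s ⟩ x → z ≤⟨ s ⟩ y → z ≤⟨ s ⟩ meet s x y
  meet-greatest s p q = unturn s (join-least (opposite s) (turn s p) (turn s q))

  bot-least : ∀ s {x} → bot s ≤⟨ s ⟩ x
  bot-least ⊕ = ⟪ minimum _ ⟫
  bot-least ⊖ = ⟪ maximum _ ⟫

  -- The left side is the two-element fold of the normality conditions; this is how normality yields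
  -- preservation of binary joins.
  join-bot : ∀ s {x y} → join s x (join s y (bot s)) ≈ join s x y
  join-bot s = ≤⟨⟩-antisym s
    (join-least s (join-ub₁ s) (join-least s (join-ub₂ s) (bot-least s)))
    (join-least s (join-ub₁ s) (≤⟨⟩-trans (join-ub₁ s) (join-ub₂ s)))

  join-absorbs : ∀ s {x y} → x ≤⟨ s ⟩ y → join s x y ≈ y
  join-absorbs s p = ≤⟨⟩-antisym s (join-least s p (≤⟨⟩-refl s)) (join-ub₂ s)

  private
    distributiveLattice : DistributiveLattice ℓ ℓ ℓ
    distributiveLattice = record
      { isDistributiveLattice = record
        { isLattice = isLattice ; ∧-distribˡ-∨ = ∧-distribˡ-∨ } }
    open DistributiveLatticeProperties distributiveLattice using (∨-distribˡ-∧)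

  join-meet-distrib : ∀ s {x y z w} → w ≤⟨ s ⟩ join s x y → w ≤⟨ s ⟩ join s x z →
                      w ≤⟨ s ⟩ join s x (meet s y z)
  join-meet-distrib s p q =
    ≤⟨⟩-trans (meet-greatest s p q) (≈⇒≤⟨⟩ s (distrib s))
    where
    distrib : ∀ s {x y z} → meet s (join s x y) (join s x z) ≈ join s x (meet s y z)
    distrib ⊕ = Eq.sym (∨-distribˡ-∧ _ _ _)
    distrib ⊖ = Eq.sym (∧-distribˡ-∨ _ _ _)

-- Closed elements, compactness, and operations on the canonical extension

module Canonical {ℓ} {L : BDL ℓ} (E : CanonicalExtension L) where
  private
    module L = BDL L
    module E = CanonicalExtension E

  A C : Set ℓ
  A = L.Carrier
  C = E.Carrier

  ι : A → C
  ι = E.ι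

  open OrientedLattice L public
    renaming ( _≤⟨_⟩_ to _⊑⟨_⟩_; ≤⟨⟩-refl to ⊑-refl; ≤⟨⟩-trans to ⊑-trans
             ; ≤⟨⟩-reflexive to ⊑-reflexive; ≈⇒≤⟨⟩ to ≈⇒⊑
             ; ≤⟨⟩-antisym to ⊑-antisym )
  open OrientedLattice E.bdl public
    using (_≤⟨_⟩_; ≤⟨⟩-refl; ≤⟨⟩-trans; ≤⟨⟩-reflexive; ≈⇒≤⟨⟩; ≤⟨⟩-antisym)
    renaming ( join to joinᶜ; join-ub₁ to joinᶜ-ub₁; join-ub₂ to joinᶜ-ub₂
             ; join-least to joinᶜ-least
             ; meet-greatest to meetᶜ-greatest; bot to botᶜ; bot-least to botᶜ-least )

  ι-join : ∀ s r {a b} → ι (join s a b) ≤⟨ r ⟩ joinᶜ s (ι a) (ι b)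
  ι-join ⊕ r = ≈⇒≤⟨⟩ r (E.ι-∨ _ _)
  ι-join ⊖ r = ≈⇒≤⟨⟩ r (E.ι-∧ _ _)

  ι-join⁻ : ∀ s r {a b} → joinᶜ s (ι a) (ι b) ≤⟨ r ⟩ ι (join s a b)
  ι-join⁻ ⊕ r = ≈⇒≤⟨⟩ r (E.Eq.sym (E.ι-∨ _ _))
  ι-join⁻ ⊖ r = ≈⇒≤⟨⟩ r (E.Eq.sym (E.ι-∧ _ _))

  ι-join-least : ∀ s {a b x} → ι a ≤⟨ s ⟩ x → ι b ≤⟨ s ⟩ x → ι (join s a b) ≤⟨ s ⟩ x
  ι-join-least s p q = ≤⟨⟩-trans (ι-join s s) (joinᶜ-least s p q)

  ι-meet-greatest : ∀ s {a b x} → x ≤⟨ s ⟩ ι a → x ≤⟨ s ⟩ ι b → x ≤⟨ s ⟩ ι (meet s a b)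
  ι-meet-greatest s p q = ≤⟨⟩-trans (meetᶜ-greatest s p q) (ι-join⁻ (opposite s) s)

  ι-bot-least : ∀ s {x} → ι (bot s) ≤⟨ s ⟩ x
  ι-bot-least ⊕ = ≤⟨⟩-trans (≈⇒≤⟨⟩ ⊕ E.ι-⊥) (botᶜ-least ⊕)
  ι-bot-least ⊖ = ≤⟨⟩-trans (≈⇒≤⟨⟩ ⊖ E.ι-⊤) (botᶜ-least ⊖)

  ι-top-greatest : ∀ s {x} → x ≤⟨ s ⟩ ι (bot (opposite s))
  ι-top-greatest s = unturn s (ι-bot-least (opposite s))

  ι-mono : ∀ s {a b} → a ⊑⟨ s ⟩ b → ι a ≤⟨ s ⟩ ι b
  ι-mono ⊕ ⟪ p ⟫ = ≤⟨⟩-trans (joinᶜ-ub₁ ⊕) (≤⟨⟩-trans (ι-join⁻ ⊕ ⊕) (≈⇒≤⟨⟩ ⊕ (E.ι-cong a∨b≈b)))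
    where a∨b≈b = L.antisym (L.∨-least p L.refl) (L.y≤x∨y _ _)
  ι-mono ⊖ ⟪ p ⟫ = turn ⊕ (ι-mono ⊕ ⟪ p ⟫)

  ι-reflect : ∀ s {a b} → ι a ≤⟨ s ⟩ ι b → a ⊑⟨ s ⟩ b
  ι-reflect ⊕ ⟪ p ⟫ = ⊑-trans (join-ub₁ ⊕) (≈⇒⊑ ⊕ (E.ι-injective
    (E.Eq.trans (E.ι-∨ _ _) (E.antisym (E.∨-least p E.refl) (E.y≤x∨y _ _)))))
  ι-reflect ⊖ ⟪ p ⟫ = turn ⊕ (ι-reflect ⊕ ⟪ p ⟫)

  -- Closed ⊕ is K and Closed ⊖ is O: k is the infimum (for the order of sign
  -- s) of the elements of A above it.
  Closed : Sign → C → Set ℓ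
  Closed s k = ∀ X → (∀ a → k ≤⟨ s ⟩ ι a → X ≤⟨ s ⟩ ι a) → X ≤⟨ s ⟩ k

  -- `u` lies below the join of `T`, stated through upper bounds so that the join need not be
  -- formed.
  Below : Sign → C → Pred A ℓ → Set ℓ
  Below s u T = ∀ X → (∀ a → T a → ι a ≤⟨ s ⟩ X) → u ≤⟨ s ⟩ X

  -- The member is required because only nonempty joins are known to be preserved; it also bounds
  -- the empty list that compactness may return.
  Directed : Sign → Pred A ℓ → Set ℓ
  Directed s T = ∃ T × (∀ {a b} → T a → T b → ∃ λ c → T c × a ⊑⟨ s ⟩ c × b ⊑⟨ s ⟩ c)

  ι-closed : ∀ s {a} → Closed s (ι a)
  ι-closed s X p = p _ (≤⟨⟩-refl s)

  infimum-closed : ∀ s {k} (S : Pred A ℓ) → (∀ a → S a → k ≤⟨ s ⟩ ι a) →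
                   (∀ X → (∀ a → S a → X ≤⟨ s ⟩ ι a) → X ≤⟨ s ⟩ k) → Closed s k
  infimum-closed s S lb glb X p = glb X λ a Sa → p a (lb a Sa)

  dense : ∀ s {u X} → (∀ k → Closed s k → k ≤⟨ s ⟩ u → k ≤⟨ s ⟩ X) → u ≤⟨ s ⟩ X
  dense ⊕ {u} {X} h =
    let P , P⊆K , ub , lub = E.join-of-meets u in
    ⟪ lub X (λ (k , Pk) →
        let S , lb , glb = P⊆K Pk in
        le (h k (infimum-closed ⊕ S (λ a Sa → ⟪ lb (a , Sa) ⟫)
                                    (λ Y q → ⟪ glb Y (λ (a , Sa) → le (q a Sa)) ⟫))
                ⟪ ub (k , Pk) ⟫)) ⟫
  dense ⊖ {u} {X} h =
    let P , P⊆O , lb , glb = E.meet-of-joins u in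
    ⟪ glb X (λ (k , Pk) →
        let T , ub , lub = P⊆O Pk in
        le (h k (infimum-closed ⊖ T (λ a Ta → ⟪ ub (a , Ta) ⟫)
                                    (λ Y q → ⟪ lub Y (λ (a , Ta) → le (q a Ta)) ⟫))
                ⟪ lb (k , Pk) ⟫)) ⟫

  codense : ∀ s {u X} → (∀ o → Closed (opposite s) o → X ≤⟨ s ⟩ o → u ≤⟨ s ⟩ o) → u ≤⟨ s ⟩ X
  codense s h = unturn s (dense (opposite s) λ o oc p → turn s (h o oc (unturn s p)))

  supremum : Sign → Pred A ℓ → C
  supremum ⊕ T = E.⋁ {I = Lift (lsuc ℓ) (∃ T)} λ (lift (a , _)) → ι a
  supremum ⊖ T = E.⋀ {I = Lift (lsuc ℓ) (∃ T)} λ (lift (a , _)) → ι a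

  supremum-ub : ∀ s {T} a → T a → ι a ≤⟨ s ⟩ supremum s T
  supremum-ub ⊕ a Ta = ⟪ proj₁ (E.⋁-sup _) (lift (a , Ta)) ⟫
  supremum-ub ⊖ a Ta = ⟪ proj₁ (E.⋀-inf _) (lift (a , Ta)) ⟫

  supremum-below : ∀ s T → Below s (supremum s T) T
  supremum-below ⊕ T X h = ⟪ proj₂ (E.⋁-sup _) X (λ (lift (a , Ta)) → le (h a Ta)) ⟫
  supremum-below ⊖ T X h = ⟪ proj₂ (E.⋀-inf _) X (λ (lift (a , Ta)) → le (h a Ta)) ⟫

  infimum : Sign → Pred A ℓ → C
  infimum s = supremum (opposite s)

  infimum-lb : ∀ s {T} a → T a → infimum s T ≤⟨ s ⟩ ι a
  infimum-lb s a Ta = unturn s (supremum-ub (opposite s) a Ta)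

  infimum-greatest : ∀ s T X → (∀ a → T a → X ≤⟨ s ⟩ ι a) → X ≤⟨ s ⟩ infimum s T
  infimum-greatest s T X h =
    unturn s (supremum-below (opposite s) T X λ a Ta → turn s (h a Ta))

  -- A finite meet of elements above k is above k, and a directed set contains
  -- an upper bound of each finite join of its elements.
  compact : ∀ s {k T} → Closed s k → Directed s T → Below s k T → ∃ λ a → T a × k ≤⟨ s ⟩ ι a
  compact ⊕ {k} {T} kc (t₀ , dir) k≤T =
    let Fs , Gs , allF , allG , F≤G =
          E.compact (λ a → k E.≤ ι a) T
            ((λ (a , p) → p) , (λ X h → le (kc X λ a p → ⟪ h (a , le p) ⟫)))
            ((λ (a , p) → le (supremum-ub ⊕ a p)) ,
             (λ X h → le (supremum-below ⊕ T X λ a p → ⟪ h (a , p) ⟫)))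
            (le (k≤T _ (supremum-ub ⊕)))
        a , Ta , G≤a = join-bound allG
    in a , Ta , ≤⟨⟩-trans (meet-bound allF) (ι-mono ⊕ (⊑-trans ⟪ F≤G ⟫ G≤a))
    where
    meet-bound : ∀ {Fs} → All (λ a → k E.≤ ι a) Fs → k ≤⟨ ⊕ ⟩ ι (L.⋀ᶠ Fs)
    meet-bound []       = ι-top-greatest ⊕
    meet-bound (p ∷ ps) = ι-meet-greatest ⊕ ⟪ p ⟫ (meet-bound ps)
    join-bound : ∀ {Gs} → All T Gs → ∃ λ a → T a × L.⋁ᶠ Gs ⊑⟨ ⊕ ⟩ a
    join-bound []       = proj₁ t₀ , proj₂ t₀ , bot-least ⊕
    join-bound (p ∷ ps) =
      let a , Ta , q = join-bound ps ; c , Tc , p≤c , a≤c = dir p Ta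
      in c , Tc , join-least ⊕ p≤c (⊑-trans q a≤c)
  compact ⊖ {k} {T} kc (t₀ , dir) k≤T =
    let Fs , Gs , allF , allG , F≤G =
          E.compact T (λ a → ι a E.≤ k)
            ((λ (a , p) → le (supremum-ub ⊖ a p)) ,
             (λ X h → le (supremum-below ⊖ T X λ a p → ⟪ h (a , p) ⟫)))
            ((λ (a , p) → p) , (λ X h → le (kc X λ a p → ⟪ h (a , le p) ⟫)))
            (le (k≤T _ (supremum-ub ⊖)))
        a , Ta , F≤a = meet-bound allF
    in a , Ta , ≤⟨⟩-trans (join-bound allG) (ι-mono ⊖ (⊑-trans ⟪ F≤G ⟫ F≤a))
    where
    join-bound : ∀ {Gs} → All (λ a → ι a E.≤ k) Gs → k ≤⟨ ⊖ ⟩ ι (L.⋁ᶠ Gs)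
    join-bound []       = ι-top-greatest ⊖
    join-bound (p ∷ ps) = ι-meet-greatest ⊖ ⟪ p ⟫ (join-bound ps)
    meet-bound : ∀ {Fs} → All T Fs → ∃ λ a → T a × L.⋀ᶠ Fs ⊑⟨ ⊖ ⟩ a
    meet-bound []       = proj₁ t₀ , proj₂ t₀ , bot-least ⊖
    meet-bound (p ∷ ps) =
      let a , Ta , q = meet-bound ps ; c , Tc , p≤c , a≤c = dir p Ta
      in c , Tc , join-least ⊖ p≤c (⊑-trans q a≤c)

  above-directed : ∀ s {k} → Directed (opposite s) (λ a → k ≤⟨ s ⟩ ι a)
  above-directed s =
    (bot (opposite s) , ι-top-greatest s) ,
    λ {a} {b} p q → meet s a b , ι-meet-greatest s p q ,
                    join-ub₁ (opposite s) , join-ub₂ (opposite s)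

  above-below : ∀ s {k} → Closed s k → Below (opposite s) k (λ a → k ≤⟨ s ⟩ ι a)
  above-below s kc X h = turn s (kc X λ a p → unturn s (h a p))

  -- Operations on `A` and `Aδ` compatible with directed joins

  Signing : ℕ → Set
  Signing m = Sign → Fin m → Sign

  -- An operation on A with an operation on C which extends it.  For
  -- operations coming from terms the latter need not be the σ- or the
  -- π-extension of the former; the field esakia is all that remains.
  record Op {m} (χ : Signing m) (f : Vector A m → A) (F : Vector C m → C) : Set (lsuc ℓ) where
    field
      χ-opposite : ∀ s h → χ (opposite s) h ≡ opposite (χ s h)
      mono   : ∀ s {a b} → (∀ h → a h ⊑⟨ χ s h ⟩ b h) → f a ⊑⟨ s ⟩ f b
      monoᶜ  : ∀ s {u v} → (∀ h → u h ≤⟨ χ s h ⟩ v h) → F u ≤⟨ s ⟩ F v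
      esakia : ∀ s {v X} (T : Fin m → Pred A ℓ) →
               (∀ h → Directed (χ s h) (T h)) → (∀ h → Below (χ s h) (v h) (T h)) →
               (∀ b → (∀ h → T h (b h)) → ι (f b) ≤⟨ s ⟩ X) → F v ≤⟨ s ⟩ X

  -- Preservation of binary meets in coordinate `j`, merged with monotonicity in the others. Being a
  -- condition on any `t` that is large enough, it can be used without rebuilding tuples by
  -- `replaceAt`.
  MeetPreserving : ∀ {m} → Sign → Signing m → (Vector A m → A) → Set ℓ
  MeetPreserving s χ f = ∀ j {p q t x} → x ⊑⟨ s ⟩ f p → x ⊑⟨ s ⟩ f q →
    (∀ h → h ≢ j → p h ⊑⟨ χ s h ⟩ t h × q h ⊑⟨ χ s h ⟩ t h) →
    (∀ y → y ⊑⟨ χ s j ⟩ p j → y ⊑⟨ χ s j ⟩ q j → y ⊑⟨ χ s j ⟩ t j) →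
    x ⊑⟨ s ⟩ f t

  Approximable : ∀ {m} → Sign → Signing m → (Vector C m → C) → Set ℓ
  Approximable s χ F = ∀ {w X} →
    (∀ x → (∀ h → Closed (χ s h) (x h)) → (∀ h → x h ≤⟨ χ s h ⟩ w h) → F x ≤⟨ s ⟩ X) →
    F w ≤⟨ s ⟩ X

  record Additive {m} (s : Sign) (χ : Signing m) (f : Vector A m → A) (F : Vector C m → C) :
         Set ℓ where
    field
      meets  : MeetPreserving (opposite s) χ f
      approx : Approximable s χ F

  module _ {m} {χ : Signing m} {f : Vector A m → A} {F : Vector C m → C} (op : Op χ f F) where
    open Op op

    turnᴬ : ∀ s h {a b} → a ⊑⟨ χ s h ⟩ b → b ⊑⟨ χ (opposite s) h ⟩ a
    turnᴬ s h p = subst (_ ⊑⟨_⟩ _) (sym (χ-opposite s h)) (turn _ p)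

    unturnᴬ : ∀ s h {a b} → a ⊑⟨ χ (opposite s) h ⟩ b → b ⊑⟨ χ s h ⟩ a
    unturnᴬ s h p = unturn _ (subst (_ ⊑⟨_⟩ _) (χ-opposite s h) p)

    -- Singletons are directed, so `esakia` applies to the tuple `a` alone.
    bounded : ∀ s {u a} → (∀ h → u h ≤⟨ χ s h ⟩ ι (a h)) → F u ≤⟨ s ⟩ ι (f a)
    bounded s {u} {a} u≤a = esakia s (λ h x → x ≡ a h)
      (λ h → (a h , refl) , λ { refl refl → a h , refl , ⊑-refl _ , ⊑-refl _ })
      (λ h X p → ≤⟨⟩-trans (u≤a h) (p (a h) refl))
      (λ b eq → ι-mono s (mono s λ h → ⊑-reflexive _ (eq h)))

    -- A closed element is a directed meet of elements of `A`, that is, a directed join for the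
    -- opposite sign, where `esakia` applies.
    closed-greatest : ∀ s {x Z} → (∀ h → Closed (χ s h) (x h)) →
                      (∀ a → (∀ h → x h ≤⟨ χ s h ⟩ ι (a h)) → Z ≤⟨ s ⟩ ι (f a)) → Z ≤⟨ s ⟩ F x
    closed-greatest s {x} xc p = unturn s (esakia (opposite s) (λ h a → x h ≤⟨ χ s h ⟩ ι a)
      (λ h → subst (λ r → Directed r (λ a → x h ≤⟨ χ s h ⟩ ι a))
                   (sym (χ-opposite s h)) (above-directed (χ s h)))
      (λ h → subst (λ r → Below r (x h) (λ a → x h ≤⟨ χ s h ⟩ ι a))
                   (sym (χ-opposite s h)) (above-below (χ s h) (xc h)))
      (λ b q → turn s (p b q)))

    -- By `closed-greatest`, `F x` is above every lower bound of the values `f a` with `a` above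
    -- `x`. These values are directed downwards, because the meet of two such tuples is again above
    -- `x`; compactness then selects one value.
    closed-compact : ∀ s {x o} → (∀ h → Closed (χ s h) (x h)) → Closed (opposite s) o → F x ≤⟨ s ⟩ o →
                     ∃ λ a → (∀ h → x h ≤⟨ χ s h ⟩ ι (a h)) × ι (f a) ≤⟨ s ⟩ o
    closed-compact s {x} {o} xc oc Fx≤o =
      let _ , (a , x≤a , eq) , o≤t = compact (opposite s) oc directed below
      in a , x≤a , ≤⟨⟩-trans (≤⟨⟩-reflexive s (cong ι eq)) (unturn s o≤t)
      where
      values : Pred A ℓ
      values t = ∃ λ a → (∀ h → x h ≤⟨ χ s h ⟩ ι (a h)) × f a ≡ t
      directed : Directed (opposite s) values
      directed =
        (_ , (λ h → bot (opposite (χ s h))) , (λ h → ι-top-greatest (χ s h)) , refl) ,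
        λ { (a , p , refl) (b , q , refl) →
            _ , ((λ h → meet (χ s h) (a h) (b h)) , (λ h → ι-meet-greatest (χ s h) (p h) (q h)) , refl)
              , mono (opposite s) (λ h → turnᴬ s h (meet-lb₁ (χ s h)))
              , mono (opposite s) (λ h → turnᴬ s h (meet-lb₂ (χ s h))) }
      below : Below (opposite s) o values
      below Z h = turn s (≤⟨⟩-trans
        (closed-greatest s xc (λ a p → unturn s (h _ (a , p , refl)))) Fx≤o)

    join-preserving : ∀ s → MeetPreserving (opposite s) χ f → ∀ j {p q t x} →
      f p ⊑⟨ s ⟩ x → f q ⊑⟨ s ⟩ x →
      (∀ h → h ≢ j → t h ⊑⟨ χ s h ⟩ p h × t h ⊑⟨ χ s h ⟩ q h) →
      t j ⊑⟨ χ s j ⟩ join (χ s j) (p j) (q j) → f t ⊑⟨ s ⟩ x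
    join-preserving s meets j fp≤x fq≤x t≤ tj≤ = unturn s (meets j (turn s fp≤x) (turn s fq≤x)
      (λ h h≢j → turnᴬ s h (proj₁ (t≤ h h≢j)) , turnᴬ s h (proj₂ (t≤ h h≢j)))
      (λ y y≤p y≤q → turnᴬ s j
        (⊑-trans tj≤ (join-least (χ s j) (unturnᴬ s j y≤p) (unturnᴬ s j y≤q)))))

    -- With Y the set of the j-th coordinates of the tuples a of A that are
    -- above x off j and satisfy f a ≤ o, the hypothesis says that every member
    -- of the family, hence w j, is below the join of Y; Y is directed because
    -- f preserves binary joins.
    coordinate-join : ∀ s → Additive s χ f F → ∀ {p} w j (Fam : Pred C p) → ∃ Fam →
      (∀ X → (∀ κ → Fam κ → κ ≤⟨ χ s j ⟩ X) → w j ≤⟨ χ s j ⟩ X) → ∀ {X} →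
      (∀ κ → Fam κ → F (replaceAt w j κ) ≤⟨ s ⟩ X) → F w ≤⟨ s ⟩ X
    coordinate-join s add w j Fam (κ₀ , Fκ₀) covered {X} hyp = codense s λ o oc X≤o →
      approx λ x xc x≤w → bound o oc X≤o x xc x≤w
      where
      open Additive add
      bound : ∀ o → Closed (opposite s) o → X ≤⟨ s ⟩ o → ∀ x → (∀ h → Closed (χ s h) (x h)) →
              (∀ h → x h ≤⟨ χ s h ⟩ w h) → F x ≤⟨ s ⟩ o
      bound o oc X≤o x xc x≤w =
        let _ , (a , eq , x≤a , fa≤o) , xj≤α = compact (χ s j) (xc j) directed below
            xj≤aj = ≤⟨⟩-trans xj≤α (≤⟨⟩-reflexive _ (cong ι (sym eq)))
        in ≤⟨⟩-trans (bounded s (λ h → at a xj≤aj x≤a h)) fa≤o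
        where
        at : ∀ a → x j ≤⟨ χ s j ⟩ ι (a j) → (∀ h → h ≢ j → x h ≤⟨ χ s h ⟩ ι (a h)) →
             ∀ h → x h ≤⟨ χ s h ⟩ ι (a h)
        at a p q h with h ≟ j
        ... | yes refl = p
        ... | no h≢j   = q h h≢j
        Y : Pred A ℓ
        Y α = ∃ λ a → a j ≡ α × (∀ h → h ≢ j → x h ≤⟨ χ s h ⟩ ι (a h)) × ι (f a) ≤⟨ s ⟩ o
        witness : ∀ κ → Fam κ → ∀ k → Closed (χ s j) k → k ≤⟨ χ s j ⟩ κ →
                  ∃ λ a → Y (a j) × k ≤⟨ χ s j ⟩ ι (a j)
        witness κ Fκ k kc k≤κ =
          let a , x≤a , fa≤o = closed-compact s
                (replaceAt-elim (λ h → Closed (χ s h)) kc (λ h _ → xc h)) oc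
                (≤⟨⟩-trans (monoᶜ s (replaceAt-elim₂ (λ h y z → y ≤⟨ χ s h ⟩ z) k≤κ (λ h _ → x≤w h)))
                           (≤⟨⟩-trans (hyp κ Fκ) X≤o))
          in a , (a , refl
                    , (λ h h≢j → subst (_≤⟨ χ s h ⟩ ι (a h)) (updateAt-minimal h j x h≢j) (x≤a h))
                    , fa≤o)
               , subst (_≤⟨ χ s j ⟩ ι (a j)) (updateAt-updates j x) (x≤a j)
        below : Below (χ s j) (x j) Y
        below Z ub = ≤⟨⟩-trans (x≤w j) (covered Z λ κ Fκ → dense (χ s j) λ k kc k≤κ →
          let a , Ya , k≤a = witness κ Fκ k kc k≤κ in ≤⟨⟩-trans k≤a (ub _ Ya))
        directed : Directed (χ s j) Y
        directed =
          (let a , Ya , _ = witness κ₀ Fκ₀ (ι (bot (χ s j))) (ι-closed (χ s j)) (ι-bot-least (χ s j))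
           in a j , Ya) ,
          λ { (a , refl , x≤a , fa≤o) (b , refl , x≤b , fb≤o) →
              let meets-ab = λ h → meet (χ s h) (a h) (b h)
                  joined   = join (χ s j) (a j) (b j)
                  c        = replaceAt meets-ab j joined
                  cj≡      = updateAt-updates j meets-ab
                  c≡       = λ h h≢j → updateAt-minimal h j meets-ab h≢j
              in joined
               , (c , cj≡
                    , (λ h h≢j → subst (λ z → x h ≤⟨ χ s h ⟩ ι z) (sym (c≡ h h≢j))
                                   (ι-meet-greatest (χ s h) (x≤a h h≢j) (x≤b h h≢j)))
                    , ≤⟨⟩-trans
                        (ι-mono s (join-preserving s meets j {p = a} {q = b}
                          (join-ub₁ s) (join-ub₂ s)
                          (λ h h≢j → subst (λ z → z ⊑⟨ χ s h ⟩ a h × z ⊑⟨ χ s h ⟩ b h)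
                            (sym (c≡ h h≢j)) (meet-lb₁ (χ s h) , meet-lb₂ (χ s h)))
                          (⊑-reflexive _ cj≡)))
                        (ι-join-least s fa≤o fb≤o))
               , join-ub₁ (χ s j) , join-ub₂ (χ s j) }

    complete-join : ∀ s → Additive s χ f F → ∀ {p} {v} (Fam : Fin m → Pred C p) →
      (∀ h → ∃ (Fam h)) →
      (∀ h X → (∀ κ → Fam h κ → κ ≤⟨ χ s h ⟩ X) → v h ≤⟨ χ s h ⟩ X) → ∀ {X} →
      (∀ κ → (∀ h → Fam h (κ h)) → F κ ≤⟨ s ⟩ X) → F v ≤⟨ s ⟩ X
    complete-join s add {v = v} Fam nonempty covered {X} hyp =
      coordinate-induction (λ w → F w ≤⟨ s ⟩ X) (λ h x → x ≡ v h) Fam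
        (λ j w eq → coordinate-join s add w j (Fam j) (nonempty j)
          (subst (λ z → ∀ X → (∀ κ → Fam j κ → κ ≤⟨ χ s j ⟩ X) → z ≤⟨ χ s j ⟩ X)
                 (sym eq) (covered j)))
        hyp v (λ h → refl)

  -- Additive unary operations are smooth: if F k ≤ o for all closed k ≤ w then
  -- w is below the join of the directed set of all a with f a ≤ o.
  unary-approximable : ∀ {χ f F} (op : Op {1} χ f F) s →
                       MeetPreserving (opposite s) χ f → Approximable s χ F
  unary-approximable {χ} {f} {F} op s meets {w} {X} hyp = codense s λ o oc X≤o →
    let Y : Pred A ℓ
        Y a = ι (f (λ _ → a)) ≤⟨ s ⟩ o
        witness : ∀ k → Closed (χ s 0F) k → k ≤⟨ χ s 0F ⟩ w 0F → ∃ λ a → Y a × k ≤⟨ χ s 0F ⟩ ι a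
        witness k kc k≤w =
          let a , k≤a , fa≤o = closed-compact op s {x = λ _ → k} (λ { 0F → kc }) oc
                                 (≤⟨⟩-trans (hyp _ (λ { 0F → kc }) (λ { 0F → k≤w })) X≤o)
          in a 0F , ≤⟨⟩-trans (ι-mono s (mono s λ { 0F → ⊑-refl _ })) fa≤o , k≤a 0F
    in esakia s (λ _ → Y)
      (λ { 0F →
        (let a , Ya , _ = witness (ι (bot (χ s 0F))) (ι-closed _) (ι-bot-least _) in a , Ya) ,
        (λ Ya Yb → _
          , ≤⟨⟩-trans (ι-mono s (join-preserving op s meets 0F (join-ub₁ s) (join-ub₂ s)
                                   (λ { 0F 0≢0 → ⊥-elim (0≢0 refl) }) (⊑-refl _)))
                      (ι-join-least s Ya Yb)
          , join-ub₁ _ , join-ub₂ _) })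
      (λ { 0F Z ub → dense _ λ k kc k≤w →
           let a , Ya , k≤a = witness k kc k≤w in ≤⟨⟩-trans k≤a (ub a Ya) })
      (λ b Yb → ≤⟨⟩-trans (ι-mono s (mono s λ { 0F → ⊑-refl _ })) (Yb 0F))
    where open Op op

  bot-op : ∀ s {χ : Signing 0} → Op χ (const (bot s)) (const (botᶜ s))
  bot-op s = record
    { χ-opposite = λ _ ()
    ; mono   = λ r _ → ⊑-refl r
    ; monoᶜ  = λ r _ → ≤⟨⟩-refl r
    ; esakia = λ r _ _ _ p → ≤⟨⟩-trans (below r) (p (λ ()) (λ ()))
    }
    where
    below : ∀ r → botᶜ s ≤⟨ r ⟩ ι (bot s)
    below r with compareSign r s
    ... | inj₁ refl = botᶜ-least s
    ... | inj₂ refl = turn s (ι-bot-least s)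

  pair-elim : ∀ {a p} {X : Set a} (P : Fin 2 → X → Set p) {x y} → P 0F x → P 1F y →
              ∀ h → P h ((x ∷ᵛ y ∷ᵛ []ᵛ) h)
  pair-elim P p q 0F = p
  pair-elim P p q 1F = q

  join-op : ∀ r → Op {2} (λ s _ → s) (λ a → join r (a 0F) (a 1F)) (λ u → joinᶜ r (u 0F) (u 1F))
  join-op r = record
    { χ-opposite = λ _ _ → refl ; mono = mono ; monoᶜ = monoᶜ ; esakia = esakia }
    where
    mono′ : ∀ {a b : Vector A 2} → (∀ h → a h ⊑⟨ r ⟩ b h) →
            join r (a 0F) (a 1F) ⊑⟨ r ⟩ join r (b 0F) (b 1F)
    mono′ p = join-least r (⊑-trans (p 0F) (join-ub₁ r)) (⊑-trans (p 1F) (join-ub₂ r))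
    mono : ∀ s {a b : Vector A 2} → (∀ h → a h ⊑⟨ s ⟩ b h) →
           join r (a 0F) (a 1F) ⊑⟨ s ⟩ join r (b 0F) (b 1F)
    mono s p with compareSign s r
    ... | inj₁ refl = mono′ p
    ... | inj₂ refl = turn r (mono′ (λ h → unturn r (p h)))
    monoᶜ′ : ∀ {u v : Vector C 2} → (∀ h → u h ≤⟨ r ⟩ v h) →
             joinᶜ r (u 0F) (u 1F) ≤⟨ r ⟩ joinᶜ r (v 0F) (v 1F)
    monoᶜ′ p = joinᶜ-least r (≤⟨⟩-trans (p 0F) (joinᶜ-ub₁ r)) (≤⟨⟩-trans (p 1F) (joinᶜ-ub₂ r))
    monoᶜ : ∀ s {u v : Vector C 2} → (∀ h → u h ≤⟨ s ⟩ v h) →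
            joinᶜ r (u 0F) (u 1F) ≤⟨ s ⟩ joinᶜ r (v 0F) (v 1F)
    monoᶜ s p with compareSign s r
    ... | inj₁ refl = monoᶜ′ p
    ... | inj₂ refl = turn r (monoᶜ′ (λ h → unturn r (p h)))
    esakia : ∀ s {v : Vector C 2} {X} (T : Fin 2 → Pred A ℓ) →
             (∀ h → Directed s (T h)) → (∀ h → Below s (v h) (T h)) →
             (∀ b → (∀ h → T h (b h)) → ι (join r (b 0F) (b 1F)) ≤⟨ s ⟩ X) →
             joinᶜ r (v 0F) (v 1F) ≤⟨ s ⟩ X
    esakia s T dir below hyp with compareSign s r
    -- Each argument is bounded separately; the other one is filled with any member of its nonempty
    -- set.
    ... | inj₁ refl = joinᶜ-least r
      (below 0F _ λ a Ta → let (b , Tb) , _ = dir 1F in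
        ≤⟨⟩-trans (ι-mono r (join-ub₁ r)) (hyp (a ∷ᵛ b ∷ᵛ []ᵛ) (pair-elim T Ta Tb)))
      (below 1F _ λ b Tb → let (a , Ta) , _ = dir 0F in
        ≤⟨⟩-trans (ι-mono r (join-ub₂ r)) (hyp (a ∷ᵛ b ∷ᵛ []ᵛ) (pair-elim T Ta Tb)))
    -- For this sign the operation is a meet: a closed element below it is below both arguments, and
    -- compactness applies to each.
    ... | inj₂ refl = dense s λ k kc k≤ →
      let a , Ta , k≤a = compact s kc (dir 0F) (λ X ub →
                           ≤⟨⟩-trans k≤ (≤⟨⟩-trans (turn r (joinᶜ-ub₁ r)) (below 0F X ub)))
          b , Tb , k≤b = compact s kc (dir 1F) (λ X ub →
                           ≤⟨⟩-trans k≤ (≤⟨⟩-trans (turn r (joinᶜ-ub₂ r)) (below 1F X ub)))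
      in ≤⟨⟩-trans (turn r (ι-join-least r (unturn r k≤a) (unturn r k≤b)))
                   (hyp (a ∷ᵛ b ∷ᵛ []ᵛ) (pair-elim T Ta Tb))

  join-meet-preserving : ∀ r s →
    MeetPreserving {2} s (λ s _ → s) (λ a → join r (a 0F) (a 1F))
  join-meet-preserving r s j {p} {q} {t} x≤p x≤q off at with compareSign s r
  join-meet-preserving r .r 0F x≤p x≤q off at | inj₁ refl = ⊑-trans
    (join-meet-distrib r
      (⊑-trans x≤p (join-least r (join-ub₂ r) (⊑-trans (proj₁ (off 1F λ ())) (join-ub₁ r))))
      (⊑-trans x≤q (join-least r (join-ub₂ r) (⊑-trans (proj₂ (off 1F λ ())) (join-ub₁ r)))))
    (join-least r (join-ub₂ r) (⊑-trans (at _ (meet-lb₁ r) (meet-lb₂ r)) (join-ub₁ r)))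
  join-meet-preserving r .r 1F x≤p x≤q off at | inj₁ refl = ⊑-trans
    (join-meet-distrib r
      (⊑-trans x≤p (join-least r (⊑-trans (proj₁ (off 0F λ ())) (join-ub₁ r)) (join-ub₂ r)))
      (⊑-trans x≤q (join-least r (⊑-trans (proj₂ (off 0F λ ())) (join-ub₁ r)) (join-ub₂ r))))
    (join-least r (join-ub₁ r) (⊑-trans (at _ (meet-lb₁ r) (meet-lb₂ r)) (join-ub₂ r)))
  join-meet-preserving r _ 0F x≤p x≤q off at | inj₂ refl = turn r (join-least r
    (unturn r (at _ (⊑-trans x≤p (turn r (join-ub₁ r))) (⊑-trans x≤q (turn r (join-ub₁ r)))))
    (unturn r (⊑-trans x≤p (⊑-trans (turn r (join-ub₂ r)) (proj₁ (off 1F λ ()))))))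
  join-meet-preserving r _ 1F x≤p x≤q off at | inj₂ refl = turn r (join-least r
    (unturn r (⊑-trans x≤p (⊑-trans (turn r (join-ub₁ r)) (proj₁ (off 0F λ ())))))
    (unturn r (at _ (⊑-trans x≤p (turn r (join-ub₂ r))) (⊑-trans x≤q (turn r (join-ub₂ r))))))

  join-additive : ∀ r s → Additive {2} s (λ s _ → s)
                    (λ a → join r (a 0F) (a 1F)) (λ u → joinᶜ r (u 0F) (u 1F))
  join-additive r s = record { meets = join-meet-preserving r (opposite s) ; approx = approx }
    where
    approx : Approximable {2} s (λ s _ → s) (λ u → joinᶜ r (u 0F) (u 1F))
    approx {w} hyp with compareSign s r
    ... | inj₁ refl = joinᶜ-least r
      (dense r λ k kc k≤w → ≤⟨⟩-trans (joinᶜ-ub₁ r) (hyp (k ∷ᵛ ι (bot r) ∷ᵛ []ᵛ)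
        (pair-elim (λ _ → Closed r) kc (ι-closed r))
        (pair-elim (λ h x → x ≤⟨ r ⟩ w h) k≤w (ι-bot-least r))))
      (dense r λ k kc k≤w → ≤⟨⟩-trans (joinᶜ-ub₂ r) (hyp (ι (bot r) ∷ᵛ k ∷ᵛ []ᵛ)
        (pair-elim (λ _ → Closed r) (ι-closed r) kc)
        (pair-elim (λ h x → x ≤⟨ r ⟩ w h) (ι-bot-least r) k≤w)))
    ... | inj₂ refl = dense s λ k kc k≤w →
      ≤⟨⟩-trans (turn r (joinᶜ-least r (≤⟨⟩-refl r) (≤⟨⟩-refl r)))
        (hyp (λ _ → k) (λ _ → kc)
          (λ { 0F → ≤⟨⟩-trans k≤w (turn r (joinᶜ-ub₁ r))
             ; 1F → ≤⟨⟩-trans k≤w (turn r (joinᶜ-ub₂ r)) }))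

  -- The σ- and π-extensions of normal operations

  JoinPreserving : ∀ {m} → Sign → Signing m → (Vector A m → A) → Set ℓ
  JoinPreserving s χ f = ∀ v j a b →
    f (replaceAt v j (join (χ s j) a b)) L.≈ join s (f (replaceAt v j a)) (f (replaceAt v j b))

  module _ {m} {χ : Signing m} (χ-opposite : ∀ s h → χ (opposite s) h ≡ opposite (χ s h))
           {f : Vector A m → A} (f-cong : ∀ {a b} → (∀ h → a h L.≈ b h) → f a L.≈ f b)
           (s : Sign) (preserving : JoinPreserving s χ f) where

    private
      replaceAt-≈ : ∀ {v : Vector A m} {j x y} → x L.≈ y → ∀ h → replaceAt v j x h L.≈ replaceAt v j y h
      replaceAt-≈ p = replaceAt-elim₂ (λ _ x y → x L.≈ y) p (λ _ _ → L.Eq.refl)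

      coordinate-mono : ∀ v j {a b} → a ⊑⟨ χ s j ⟩ b → f (replaceAt v j a) ⊑⟨ s ⟩ f (replaceAt v j b)
      coordinate-mono v j {a} {b} p = ⊑-trans (join-ub₁ s) (≈⇒⊑ s
        (L.Eq.trans (L.Eq.sym (preserving v j a b)) (f-cong (replaceAt-≈ (join-absorbs _ p)))))

      replaceAt-self : ∀ v j {x} → v j L.≈ x → f v L.≈ f (replaceAt v j x)
      replaceAt-self v j p = f-cong (replaceAt-elim (λ h x → v h L.≈ x) p (λ _ _ → L.Eq.refl))

      mono-s : ∀ {a b} → (∀ h → a h ⊑⟨ χ s h ⟩ b h) → f a ⊑⟨ s ⟩ f b
      mono-s {a} {b} p = coordinate-induction (λ w → f w ⊑⟨ s ⟩ f b) (λ h x → x ≡ a h) (λ h x → x ≡ b h)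
        (λ j w eq rest → ⊑-trans (≈⇒⊑ s (replaceAt-self w j L.Eq.refl))
          (⊑-trans (coordinate-mono w j (⊑-trans (⊑-reflexive _ eq) (p j))) (rest _ refl)))
        (λ w eq → ≈⇒⊑ s (f-cong λ h → L.Eq.reflexive (eq h)))
        a (λ _ → refl)

    join-preserving-mono : ∀ r {a b} → (∀ h → a h ⊑⟨ χ r h ⟩ b h) → f a ⊑⟨ r ⟩ f b
    join-preserving-mono r p with compareSign r s
    ... | inj₁ refl = mono-s p
    ... | inj₂ refl = turn s (mono-s λ h → unturn _ (subst (_ ⊑⟨_⟩ _) (χ-opposite s h) (p h)))

    -- For sign `s`, `t` is below the join of `p` and `q` at `j` and below both elsewhere. Expanding
    -- that join leaves two tuples, one below `p` and one below `q`.
    join-preserving-meets : MeetPreserving (opposite s) χ f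
    join-preserving-meets j {p} {q} {t} {x} x≤p x≤q off at = turn s
      (⊑-trans (≈⇒⊑ s (replaceAt-self t j L.Eq.refl))
      (⊑-trans (coordinate-mono t j tj≤)
      (⊑-trans (≈⇒⊑ s (preserving t j (p j) (q j)))
        (join-least s
          (⊑-trans (mono-s (replaceAt-elim (λ h y → y ⊑⟨ χ s h ⟩ p h) (⊑-refl _)
                             λ h h≢j → turned h (proj₁ (off h h≢j))))
                   (unturn s x≤p))
          (⊑-trans (mono-s (replaceAt-elim (λ h y → y ⊑⟨ χ s h ⟩ q h) (⊑-refl _)
                             λ h h≢j → turned h (proj₂ (off h h≢j))))
                   (unturn s x≤q))))))
      where
      turned : ∀ h {y z} → y ⊑⟨ χ (opposite s) h ⟩ z → z ⊑⟨ χ s h ⟩ y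
      turned h p = unturn _ (subst (_ ⊑⟨_⟩ _) (χ-opposite s h) p)
      turned⁻ : ∀ h {y z} → y ⊑⟨ χ s h ⟩ z → z ⊑⟨ χ (opposite s) h ⟩ y
      turned⁻ h p = subst (_ ⊑⟨_⟩ _) (sym (χ-opposite s h)) (turn _ p)
      tj≤ : t j ⊑⟨ χ s j ⟩ join (χ s j) (p j) (q j)
      tj≤ = turned j (at _ (turned⁻ j (join-ub₁ _)) (turned⁻ j (join-ub₂ _)))

  -- F is the σ-extension of f if s is ⊕ and its π-extension if s is ⊖.
  record ClosedExtension {m} (s : Sign) (χ : Signing m) (f : Vector A m → A) (F : Vector C m → C) :
         Set ℓ where
    field
      above : ∀ {x w : Vector C m} {Z} → (∀ h → Closed (χ s h) (x h)) → (∀ h → x h ≤⟨ χ s h ⟩ w h) →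
              (∀ (a : Vector A m) → (∀ h → x h ≤⟨ χ s h ⟩ ι (a h)) → Z ≤⟨ s ⟩ ι (f a)) → Z ≤⟨ s ⟩ F w
      least : ∀ {w : Vector C m} {X} →
              (∀ (x : Vector C m) → (∀ h → Closed (χ s h) (x h)) → (∀ h → x h ≤⟨ χ s h ⟩ w h) →
               ∀ z → (∀ (a : Vector A m) → (∀ h → x h ≤⟨ χ s h ⟩ ι (a h)) → z ≤⟨ s ⟩ ι (f a)) →
               z ≤⟨ s ⟩ X) →
              F w ≤⟨ s ⟩ X

  module _ {m} {χ : Signing m} (χ-opposite : ∀ s h → χ (opposite s) h ≡ opposite (χ s h))
           {f : Vector A m → A} {F : Vector C m → C}
           (f-mono : ∀ s {a b} → (∀ h → a h ⊑⟨ χ s h ⟩ b h) → f a ⊑⟨ s ⟩ f b)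
           {s} (ext : ClosedExtension s χ f F) where
    open ClosedExtension ext

    closed-extension-op : Op χ f F
    closed-extension-op = record
      { χ-opposite = χ-opposite ; mono = f-mono ; monoᶜ = monoᶜ ; esakia = esakia }
      where
      monoᶜ-s : ∀ {u v} → (∀ h → u h ≤⟨ χ s h ⟩ v h) → F u ≤⟨ s ⟩ F v
      monoᶜ-s p = least λ x xc x≤u z z≤ → above xc (λ h → ≤⟨⟩-trans (x≤u h) (p h)) z≤
      monoᶜ : ∀ r {u v} → (∀ h → u h ≤⟨ χ r h ⟩ v h) → F u ≤⟨ r ⟩ F v
      monoᶜ r p with compareSign r s
      ... | inj₁ refl = monoᶜ-s p
      ... | inj₂ refl =
        turn s (monoᶜ-s λ h → unturn _ (subst (_ ≤⟨_⟩ _) (χ-opposite s h) (p h)))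
      esakia : ∀ r {v X} (T : Fin m → Pred A ℓ) →
               (∀ h → Directed (χ r h) (T h)) → (∀ h → Below (χ r h) (v h) (T h)) →
               (∀ b → (∀ h → T h (b h)) → ι (f b) ≤⟨ r ⟩ X) → F v ≤⟨ r ⟩ X
      esakia r {v} {X} T dir below hyp with compareSign r s
      ... | inj₁ refl = least λ x xc x≤v z z≤ →
        -- Each coordinate of `x` is closed, hence below a member of the directed set in that
        -- coordinate.
        let choice = λ h → compact (χ s h) (xc h) (dir h) λ Y ub → ≤⟨⟩-trans (x≤v h) (below h Y ub)
        in ≤⟨⟩-trans (z≤ (proj₁ ∘ choice) (λ h → proj₂ (proj₂ (choice h))))
                     (hyp _ (λ h → proj₁ (proj₂ (choice h))))
      -- For the other sign, the infima of the sets `T h` form a closed tuple below `v`. By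
      -- compactness, a tuple of `A` above it is above some tuple chosen from `T`.
      ... | inj₂ refl = turn s (above {x = λ h → infimum (χ s h) (T h)}
        (λ h → infimum-closed (χ s h) (T h) (λ a Ta → infimum-lb (χ s h) a Ta)
                              (infimum-greatest (χ s h) (T h)))
        (λ h → unturn (χ s h) (below′ h _ (supremum-ub (opposite (χ s h)))))
        (λ a inf≤a →
          let choice = λ h → compact (opposite (χ s h)) (ι-closed (opposite (χ s h)) {a h}) (dir′ h)
                (λ Y ub → ≤⟨⟩-trans (turn (χ s h) (inf≤a h))
                            (supremum-below (opposite (χ s h)) (T h) Y ub))
          in ≤⟨⟩-trans (unturn s (hyp (proj₁ ∘ choice) (λ h → proj₁ (proj₂ (choice h)))))
               (ι-mono s (f-mono s λ h → ι-reflect (χ s h) (unturn (χ s h) (proj₂ (proj₂ (choice h))))))))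
        where
        dir′ : ∀ h → Directed (opposite (χ s h)) (T h)
        dir′ h = subst (λ t → Directed t (T h)) (χ-opposite s h) (dir h)
        below′ : ∀ h → Below (opposite (χ s h)) (v h) (T h)
        below′ h = subst (λ t → Below t (v h) (T h)) (χ-opposite s h) (below h)

    closed-extension-approximable : Approximable s χ F
    closed-extension-approximable hyp = least λ x xc x≤w z z≤ →
      ≤⟨⟩-trans (above xc (λ h → ≤⟨⟩-refl _) z≤) (hyp x xc x≤w)

  module _ {m} (e : Vector OrderType m) {χ : Signing m} (χ≡act : ∀ s h → χ s h ≡ act (e h) s) where

    signing-opposite : ∀ s h → χ (opposite s) h ≡ opposite (χ s h)
    signing-opposite s h = trans (χ≡act (opposite s) h)
      (trans (act-opposite (e h) s) (cong opposite (sym (χ≡act s h))))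

    toProduct : ∀ s {x y : Vector C m} → (∀ h → x h ≤⟨ χ s h ⟩ y h) → orient (Product≤ E._≤_ e) s x y
    toProduct ⊕ p h with e h | χ ⊕ h | χ≡act ⊕ h | p h
    ... | 𝟙 | _ | refl | ⟪ q ⟫ = q
    ... | ∂ | _ | refl | ⟪ q ⟫ = q
    toProduct ⊖ p h with e h | χ ⊖ h | χ≡act ⊖ h | p h
    ... | 𝟙 | _ | refl | ⟪ q ⟫ = q
    ... | ∂ | _ | refl | ⟪ q ⟫ = q

    fromProduct : ∀ s {x y : Vector C m} → orient (Product≤ E._≤_ e) s x y → ∀ h → x h ≤⟨ χ s h ⟩ y h
    fromProduct ⊕ p h with e h | χ ⊕ h | χ≡act ⊕ h | p h
    ... | 𝟙 | _ | refl | q = ⟪ q ⟫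
    ... | ∂ | _ | refl | q = ⟪ q ⟫
    fromProduct ⊖ p h with e h | χ ⊖ h | χ≡act ⊖ h | p h
    ... | 𝟙 | _ | refl | q = ⟪ q ⟫
    ... | ∂ | _ | refl | q = ⟪ q ⟫

    -- Closedness in the product is coordinatewise: an element above `x h` is completed to a tuple
    -- above `x` by tops in the other coordinates.
    closed-product : ∀ s {x : Vector C m} → (∀ h → Closed (χ s h) (x h)) → ∀ (y : Vector C m) →
                     (∀ (a : Vector A m) → (∀ h → x h ≤⟨ χ s h ⟩ ι (a h)) →
                      ∀ h → y h ≤⟨ χ s h ⟩ ι (a h)) →
                     ∀ h → y h ≤⟨ χ s h ⟩ x h
    closed-product s {x} xc y lb h = xc h (y h) λ α x≤α →
      let tops = λ h → bot (opposite (χ s h)) in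
      subst (λ z → y h ≤⟨ χ s h ⟩ ι z) (updateAt-updates h tops)
        (lb (replaceAt tops h α)
            (replaceAt-elim (λ h a → x h ≤⟨ χ s h ⟩ ι a) x≤α (λ h _ → ι-top-greatest (χ s h))) h)

    product-closed : ∀ s {x : Vector C m} (S : Pred (Vector A m) ℓ) →
                     (∀ a → S a → ∀ h → x h ≤⟨ χ s h ⟩ ι (a h)) →
                     (∀ (y : Vector C m) → (∀ a → S a → ∀ h → y h ≤⟨ χ s h ⟩ ι (a h)) →
                      ∀ h → y h ≤⟨ χ s h ⟩ x h) →
                     ∀ h → Closed (χ s h) (x h)
    product-closed s {x} S lb glb h X p =
      subst (_≤⟨ χ s h ⟩ x h) (updateAt-updates h x)
        (glb (replaceAt x h X)
             (λ a Sa → replaceAt-elim (λ h z → z ≤⟨ χ s h ⟩ ι (a h))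
                         (p (a h) (lb a Sa h)) (λ h _ → lb a Sa h))
             h)

    module _ (f : Vector A m → A) where
      private module X = Extension (Product≤ E._≤_ e) (ι ∘_)

      σ-closed-extension : ClosedExtension ⊕ χ f (X.σ-extension E.completeBDL (ι ∘ f))
      σ-closed-extension = record
        { above = λ {x} {w} {Z} xc x≤w Z≤ → ≤⟨⟩-trans
            ⟪ proj₂ (E.⋀-inf _) Z (λ (lift (a , x≤a)) → le (Z≤ a (fromProduct ⊕ x≤a))) ⟫
            ⟪ proj₁ (E.⋁-sup _)
                ( x
                , E.⋀ {I = Lift (lsuc ℓ) (∃ λ a → Product≤ E._≤_ e x (ι ∘ a))}
                      (λ (lift (a , _)) → ι (f a))
                , ( (λ a → Product≤ E._≤_ e x (ι ∘ a))
                  , (λ (a , x≤a) → x≤a)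
                  , (λ y lb → toProduct ⊕ (closed-product ⊕ xc y λ a x≤a →
                                fromProduct ⊕ (lb (a , toProduct ⊕ x≤a)))) )
                , toProduct ⊕ x≤w
                , (λ p → proj₁ (E.⋀-inf _) (lift p))
                , (λ y lb → proj₂ (E.⋀-inf _) y (λ (lift p) → lb p)) ) ⟫
        ; least = λ {w} {X} hyp → ⟪ proj₂ (E.⋁-sup _) X
            (λ (x , z , (S , lb , glb) , x≤w , z≤ , _) →
              le (hyp x (product-closed ⊕ S (λ a Sa → fromProduct ⊕ (lb (a , Sa)))
                          (λ y p → fromProduct ⊕ (glb y λ (a , Sa) → toProduct ⊕ (p a Sa))))
                      (fromProduct ⊕ x≤w) z (λ a x≤a → ⟪ z≤ (a , toProduct ⊕ x≤a) ⟫))) ⟫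
        }

      π-closed-extension : ClosedExtension ⊖ χ f (X.π-extension E.completeBDL (ι ∘ f))
      π-closed-extension = record
        { above = λ {x} {w} {Z} xc x≤w Z≤ → ≤⟨⟩-trans
            ⟪ proj₂ (E.⋁-sup _) Z (λ (lift (a , x≤a)) → le (Z≤ a (fromProduct ⊖ x≤a))) ⟫
            ⟪ proj₁ (E.⋀-inf _)
                ( x
                , E.⋁ {I = Lift (lsuc ℓ) (∃ λ a → Product≤ E._≤_ e (ι ∘ a) x)}
                      (λ (lift (a , _)) → ι (f a))
                , ( (λ a → Product≤ E._≤_ e (ι ∘ a) x)
                  , (λ (a , x≤a) → x≤a)
                  , (λ y lb → toProduct ⊖ (closed-product ⊖ xc y λ a x≤a →
                                fromProduct ⊖ (lb (a , toProduct ⊖ x≤a)))) )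
                , toProduct ⊖ x≤w
                , (λ p → proj₁ (E.⋁-sup _) (lift p))
                , (λ y lb → proj₂ (E.⋁-sup _) y (λ (lift p) → lb p)) ) ⟫
        ; least = λ {w} {X} hyp → ⟪ proj₂ (E.⋀-inf _) X
            (λ (x , z , (S , lb , glb) , x≤w , z≤ , _) →
              le (hyp x (product-closed ⊖ S (λ a Sa → fromProduct ⊖ (lb (a , Sa)))
                          (λ y p → fromProduct ⊖ (glb y λ (a , Sa) → toProduct ⊖ (p a Sa))))
                      (fromProduct ⊖ x≤w) z (λ a x≤a → ⟪ z≤ (a , toProduct ⊖ x≤a) ⟫))) ⟫
        }

    module _ (f : Vector A m → A) (f-cong : ∀ {a b} → (∀ h → a h L.≈ b h) → f a L.≈ f b) where
      private
        module X = Extension (Product≤ E._≤_ e) (ι ∘_)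

        congAt : ∀ {v : Vector A m} {j x y} → x L.≈ y → f (replaceAt v j x) L.≈ f (replaceAt v j y)
        congAt p = f-cong (replaceAt-elim₂ (λ _ x y → x L.≈ y) p (λ _ _ → L.Eq.refl))

      module _ (normal : ∀ v j → JoinNormal L (e j) (InCoordinate L f v j)) where

        private
          preserving : JoinPreserving ⊕ χ f
          -- Normality is applied to the list of `a` and `b`; `join-bot` removes the unit at its
          -- end.
          preserving v j a b with χ ⊕ j | e j | χ≡act ⊕ j | normal v j
          ... | _ | 𝟙 | refl | n = L.Eq.trans (congAt (L.Eq.sym (join-bot ⊕)))
                                    (L.Eq.trans (n (a ∷ b ∷ [])) (join-bot ⊕))
          ... | _ | ∂ | refl | n = L.Eq.trans (congAt (L.Eq.sym (join-bot ⊖)))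
                                    (L.Eq.trans (n (a ∷ b ∷ [])) (join-bot ⊕))

          f-mono : ∀ s {a b} → (∀ h → a h ⊑⟨ χ s h ⟩ b h) → f a ⊑⟨ s ⟩ f b
          f-mono = join-preserving-mono signing-opposite f-cong ⊕ preserving

        σ-extension-op : Op χ f (X.σ-extension E.completeBDL (ι ∘ f))
        σ-extension-op = closed-extension-op signing-opposite f-mono (σ-closed-extension f)

        σ-extension-additive : Additive ⊕ χ f (X.σ-extension E.completeBDL (ι ∘ f))
        σ-extension-additive = record
          { meets  = join-preserving-meets signing-opposite f-cong ⊕ preserving
          ; approx = closed-extension-approximable signing-opposite f-mono (σ-closed-extension f) }

      module _ (normal : ∀ v j → MeetNormal L (e j) (InCoordinate L f v j)) where

        private
          preserving : JoinPreserving ⊖ χ f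
          preserving v j a b with χ ⊖ j | e j | χ≡act ⊖ j | normal v j
          ... | _ | 𝟙 | refl | n = L.Eq.trans (congAt (L.Eq.sym (join-bot ⊖)))
                                    (L.Eq.trans (n (a ∷ b ∷ [])) (join-bot ⊖))
          ... | _ | ∂ | refl | n = L.Eq.trans (congAt (L.Eq.sym (join-bot ⊕)))
                                    (L.Eq.trans (n (a ∷ b ∷ [])) (join-bot ⊖))

          f-mono : ∀ s {a b} → (∀ h → a h ⊑⟨ χ s h ⟩ b h) → f a ⊑⟨ s ⟩ f b
          f-mono = join-preserving-mono signing-opposite f-cong ⊖ preserving

        π-extension-op : Op χ f (X.π-extension E.completeBDL (ι ∘ f))
        π-extension-op = closed-extension-op signing-opposite f-mono (π-closed-extension f)

        π-extension-additive : Additive ⊖ χ f (X.π-extension E.completeBDL (ι ∘ f))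
        π-extension-additive = record
          { meets  = join-preserving-meets signing-opposite f-cong ⊖ preserving
          ; approx = closed-extension-approximable signing-opposite f-mono (π-closed-extension f) }

-- Terms of DLE and DLE⋆

module _ {o} {𝒮 : Signature o} where

  -- The labels that preserve nonempty joins of sign `s` in each argument. By distributivity `∧̂`
  -- and `∨̂` do so for both signs.
  data Additivity : Sign → Label 𝒮 → Set o where
    ∧-additive : ∀ {s} → Additivity s ∧̂
    ∨-additive : ∀ {s} → Additivity s ∨̂
    f-additive : ∀ {f} → Additivity ⊕ (𝕗 f)
    g-additive : ∀ {g} → Additivity ⊖ (𝕘 g)

  data IsMeet : Sign → Label 𝒮 → Set o where
    +∧ : IsMeet ⊕ ∧̂
    -∨ : IsMeet ⊖ ∨̂

  actᵒ≡act : ∀ e s → actᵒ {𝒮 = 𝒮} e s ≡ act e s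
  actᵒ≡act 𝟙 s = refl
  actᵒ≡act ∂ s = refl

  -- The valuation gives a value to each occurrence, so that critical and other occurrences of one
  -- variable can be evaluated differently.
  eval : ∀ {a n} {X : Set a} → (∀ c → Vector X (arity {𝒮 = 𝒮} c) → X) →
         (t : Term 𝒮 n) → (∀ x → Branch x t → X) → X
  eval apply (var x)       w = w x leaf
  eval apply (node c args) w = apply c λ h → eval apply (args h) λ x b → w x (step h b)

  actParity : Parity → Sign → Sign
  actParity 0ℙ s = s
  actParity 1ℙ s = opposite s

  -- Turns the parity condition on a unary term into the uniform leaf sign required by `unary-op`.
  leafSign-parity : ∀ {n} {t : Term 𝒮 n} {x} s (b : Branch x t) →
                    leafSign s b ≡ actParity (ℕ.parity (∂-places b)) s
  leafSign-parity s leaf = refl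
  leafSign-parity s (step {c = c} j b) with orderType c j
  ... | 𝟙 = leafSign-parity s b
  ... | ∂ = trans (leafSign-parity (opposite s) b)
                  (sym (trans (cong (λ p → actParity p s) (parity-suc (∂-places b)))
                              (actParity-⁻¹ (ℕ.parity (∂-places b)) s)))
    where
    parity-suc : ∀ n → ℕ.parity (ℕ.suc n) ≡ ℕ.parity n ⁻¹
    parity-suc 0                 = refl
    parity-suc 1                 = refl
    parity-suc (ℕ.suc (ℕ.suc n)) = parity-suc n
    actParity-⁻¹ : ∀ p s → actParity (p ⁻¹) s ≡ actParity p (opposite s)
    actParity-⁻¹ 0ℙ s = refl
    actParity-⁻¹ 1ℙ ⊕ = refl
    actParity-⁻¹ 1ℙ ⊖ = refl

module _ {ℓ} {L : BDL ℓ} (E : CanonicalExtension L) where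
  private module L = BDL L
  open Canonical E

  -- One interface for two signatures: over `𝒮` it makes unary terms into operations, and over `𝒮 ⋆`
  -- these interpret the new connectives. The last two fields identify the lattice operations on
  -- `A`, as adjoint nodes require.
  record Interpretation {o} (𝒮 : Signature o) : Set (o ⊔ lsuc ℓ) where
    field
      applyᴬ   : ∀ c → Vector A (arity {𝒮 = 𝒮} c) → A
      applyᶜ   : ∀ c → Vector C (arity {𝒮 = 𝒮} c) → C
      op       : ∀ c → Op (λ s h → childSign s c h) (applyᴬ c) (applyᶜ c)
      additive : ∀ {s c} → Additivity s c → Additive s (λ s h → childSign s c h) (applyᴬ c) (applyᶜ c)
      ∧-apply  : ∀ x → applyᴬ ∧̂ x ≡ x 0F L.∧ x 1F
      ∨-apply  : ∀ x → applyᴬ ∨̂ x ≡ x 0F L.∨ x 1F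

module Evaluation {ℓ} {L : BDL ℓ} (E : CanonicalExtension L)
                  {o} {𝒮 : Signature o} (I : Interpretation E 𝒮) where
  open Canonical E
  open Interpretation I

  meet-lower : ∀ {s c} → IsMeet s c → ∀ {x p} → x ⊑⟨ s ⟩ applyᴬ c p →
               ∀ h → x ⊑⟨ childSign s c h ⟩ p h
  meet-lower +∧ {x} {p} q 0F = ⊑-trans (subst (x ⊑⟨ ⊕ ⟩_) (∧-apply p) q) (meet-lb₁ ⊕)
  meet-lower +∧ {x} {p} q 1F = ⊑-trans (subst (x ⊑⟨ ⊕ ⟩_) (∧-apply p) q) (meet-lb₂ ⊕)
  meet-lower -∨ {x} {p} q 0F = ⊑-trans (subst (x ⊑⟨ ⊖ ⟩_) (∨-apply p) q) (meet-lb₁ ⊖)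
  meet-lower -∨ {x} {p} q 1F = ⊑-trans (subst (x ⊑⟨ ⊖ ⟩_) (∨-apply p) q) (meet-lb₂ ⊖)

  meet-upper : ∀ {s c} → IsMeet s c → ∀ {x p} → (∀ h → x ⊑⟨ childSign s c h ⟩ p h) →
               x ⊑⟨ s ⟩ applyᴬ c p
  meet-upper +∧ {x} {p} q = subst (x ⊑⟨ ⊕ ⟩_) (sym (∧-apply p)) (meet-greatest ⊕ (q 0F) (q 1F))
  meet-upper -∨ {x} {p} q = subst (x ⊑⟨ ⊖ ⟩_) (sym (∨-apply p)) (meet-greatest ⊖ (q 0F) (q 1F))

  evalᴬ : ∀ {n} (t : Term 𝒮 n) → (∀ x → Branch x t → A) → A
  evalᴬ = eval applyᴬ

  evalᶜ : ∀ {n} (t : Term 𝒮 n) → (∀ x → Branch x t → C) → C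
  evalᶜ = eval applyᶜ

  evalᴬ-mono : ∀ {n} s (t : Term 𝒮 n) {w w′} →
               (∀ x b → w x b ⊑⟨ leafSign s b ⟩ w′ x b) → evalᴬ t w ⊑⟨ s ⟩ evalᴬ t w′
  evalᴬ-mono s (var x)       p = p x leaf
  evalᴬ-mono s (node c args) p =
    Op.mono (op c) s λ h → evalᴬ-mono _ (args h) λ x b → p x (step h b)

  evalᶜ-mono : ∀ {n} s (t : Term 𝒮 n) {w w′} →
               (∀ x b → w x b ≤⟨ leafSign s b ⟩ w′ x b) → evalᶜ t w ≤⟨ s ⟩ evalᶜ t w′
  evalᶜ-mono s (var x)       p = p x leaf
  evalᶜ-mono s (node c args) p =
    Op.monoᶜ (op c) s λ h → evalᶜ-mono _ (args h) λ x b → p x (step h b)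

  -- Induction on the term: along `J`, the values of each argument form a directed set, to which
  -- `esakia` of the root applies. The indices picked for the separate arguments are then dominated
  -- by a single one.
  eval-esakia : ∀ {n} s (t : Term 𝒮 n) {J : Set ℓ} {u : ∀ x → Branch x t → C}
    (w : J → ∀ x → Branch x t → A) → J →
    (∀ i j → ∃ λ k → (∀ x b → w i x b ⊑⟨ leafSign s b ⟩ w k x b) ×
                     (∀ x b → w j x b ⊑⟨ leafSign s b ⟩ w k x b)) →
    (∀ x b X → (∀ i → ι (w i x b) ≤⟨ leafSign s b ⟩ X) → u x b ≤⟨ leafSign s b ⟩ X) →
    ∀ {X} → (∀ i → ι (evalᴬ t (w i)) ≤⟨ s ⟩ X) → evalᶜ t u ≤⟨ s ⟩ X
  eval-esakia s (var x) w i₀ directed below hyp = below x leaf _ hyp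
  eval-esakia s (node c args) {J} w i₀ directed below hyp = Op.esakia (op c) s
    (λ h a → ∃ λ i → evalᴬ (args h) (restrict h i) ≡ a)
    (λ h → (_ , i₀ , refl) ,
      λ { (i , refl) (j , refl) →
          let k , i≼k , j≼k = directed i j
          in _ , (k , refl) , evalᴬ-mono _ (args h) (λ x b → i≼k x (step h b))
                            , evalᴬ-mono _ (args h) (λ x b → j≼k x (step h b)) })
    (λ h X ub → eval-esakia _ (args h) (restrict h) i₀
      (λ i j → let k , i≼k , j≼k = directed i j
               in k , (λ x b → i≼k x (step h b)) , (λ x b → j≼k x (step h b)))
      (λ x b → below x (step h b))
      (λ i → ub _ (i , refl)))
    (λ b values →
      let k , ≼k = finite-upper-bound
            (λ i j → ∀ x b → w i x b ⊑⟨ leafSign s b ⟩ w j x b)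
            (λ p q x b → ⊑-trans (p x b) (q x b)) i₀ directed (proj₁ ∘ values)
      in ≤⟨⟩-trans
           (ι-mono s (Op.mono (op c) s λ h →
             ⊑-trans (⊑-reflexive _ (sym (proj₂ (values h))))
                     (evalᴬ-mono _ (args h) λ x b → ≼k h x (step h b))))
           (hyp k))
    where
    restrict : ∀ h → J → ∀ x → Branch x (args h) → A
    restrict h i x b = w i x (step h b)

  -- As all occurrences carry the same sign, a set directed for the variable is directed at every
  -- occurrence and can serve as the index set of `eval-esakia`.
  unary-op : (t : Term 𝒮 1) {χ : Signing 1} → (∀ s h → χ (opposite s) h ≡ opposite (χ s h)) →
             (∀ s (b : Branch 0F t) → leafSign s b ≡ χ s 0F) →
             Op χ (λ a → evalᴬ t (λ _ _ → a 0F)) (λ u → evalᶜ t (λ _ _ → u 0F))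
  unary-op t {χ} χ-opposite leaf≡ = record
    { χ-opposite = χ-opposite
    ; mono   = λ s p → evalᴬ-mono s t λ { 0F b → subst (_ ⊑⟨_⟩ _) (sym (leaf≡ s b)) (p 0F) }
    ; monoᶜ  = λ s p → evalᶜ-mono s t λ { 0F b → subst (_ ≤⟨_⟩ _) (sym (leaf≡ s b)) (p 0F) }
    ; esakia = λ s T directed below hyp →
        eval-esakia s t {J = ∃ (T 0F)} (λ (a , _) _ _ → a) (proj₁ (directed 0F))
          (λ (a , Ta) (b , Tb) →
            let c , Tc , a≤c , b≤c = proj₂ (directed 0F) Ta Tb
            in (c , Tc) , (λ { 0F br → subst (_ ⊑⟨_⟩ _) (sym (leaf≡ s br)) a≤c })
                        , (λ { 0F br → subst (_ ⊑⟨_⟩ _) (sym (leaf≡ s br)) b≤c }))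
          (λ { 0F br X ub → subst (_ ≤⟨_⟩ X) (sym (leaf≡ s br))
                 (below 0F X λ a Ta → subst (_ ≤⟨_⟩ X) (leaf≡ s br) (ub (a , Ta))) })
          (λ (a , Ta) → hyp (λ _ → a) λ { 0F → Ta })
    }

  applyᴬ-cong : ∀ c {a b} → (∀ h → BDL._≈_ L (a h) (b h)) → BDL._≈_ L (applyᴬ c a) (applyᴬ c b)
  applyᴬ-cong c p = ⊑-antisym ⊕
    (Op.mono (op c) ⊕ λ h → ≈⇒⊑ _ (p h))
    (Op.mono (op c) ⊕ λ h → ≈⇒⊑ _ (BDL.Eq.sym L (p h)))

  applyᶜ-cong : ∀ c {u v} → (∀ h → CanonicalExtension._≈_ E (u h) (v h)) →
                CanonicalExtension._≈_ E (applyᶜ c u) (applyᶜ c v)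
  applyᶜ-cong c p = ≤⟨⟩-antisym ⊕
    (Op.monoᶜ (op c) ⊕ λ h → ≈⇒≤⟨⟩ _ (p h))
    (Op.monoᶜ (op c) ⊕ λ h → ≈⇒≤⟨⟩ _ (CanonicalExtension.Eq.sym E (p h)))

module _ {o ℓ} {𝒮 : Signature o} (alg : Algebra 𝒮 ℓ) where
  open Algebra alg

  apply : ∀ c → Vector Carrier (arity {𝒮 = 𝒮} c) → Carrier
  apply ⊥̂     x = ⊥
  apply ⊤̂     x = ⊤
  apply ∧̂     x = x 0F ∧ x 1F
  apply ∨̂     x = x 0F ∨ x 1F
  apply (𝕗 f) x = ⟦𝕗⟧ f x
  apply (𝕘 g) x = ⟦𝕘⟧ g x

  evalUnary : Term 𝒮 1 → Carrier → Carrier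
  evalUnary t x = eval apply t λ _ _ → x

  module _ (apply-cong : ∀ c {x y} → (∀ h → x h ≈ y h) → apply c x ≈ apply c y) where

    -- Holds up to `≈`: arguments of a node are functions compared pointwise, and `apply-cong` lifts
    -- this to the node.
    eval-[] : ∀ {n} (t : Term 𝒮 1) {θ : Term 𝒮 n} {v x} → ⟦ θ ⟧ v ≈ x → ⟦ t [ θ ] ⟧ v ≈ evalUnary t x
    eval-[] (var _)             p = p
    eval-[] (node ⊥̂ args)     p = Eq.refl
    eval-[] (node ⊤̂ args)     p = Eq.refl
    eval-[] (node ∧̂ args) {θ} {v} p =
      apply-cong ∧̂ {λ h → ⟦ args h [ θ ] ⟧ v} {λ h → eval apply (args h) _} λ h → eval-[] (args h) p
    eval-[] (node ∨̂ args) {θ} {v} p =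
      apply-cong ∨̂ {λ h → ⟦ args h [ θ ] ⟧ v} {λ h → eval apply (args h) _} λ h → eval-[] (args h) p
    eval-[] (node (𝕗 f) args) p = apply-cong (𝕗 f) λ h → eval-[] (args h) p
    eval-[] (node (𝕘 g) args) p = apply-cong (𝕘 g) λ h → eval-[] (args h) p

    module _ (π σ lam ρ : Term 𝒮 1) where

      apply⋆ : ∀ c → Vector Carrier (arity {𝒮 = 𝒮 ⋆} c) → Carrier
      apply⋆ ⊥̂             x = ⊥
      apply⋆ ⊤̂             x = ⊤
      apply⋆ ∧̂             x = x 0F ∧ x 1F
      apply⋆ ∨̂             x = x 0F ∨ x 1F
      apply⋆ (𝕗 (old f))   x = ⟦𝕗⟧ f x
      apply⋆ (𝕘 (old g))   x = ⟦𝕘⟧ g x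
      apply⋆ (𝕗 ◇̇)        x = evalUnary π (x 0F)
      apply⋆ (𝕘 □̇)        x = evalUnary σ (x 0F)
      apply⋆ (𝕗 ⊲̇)        x = evalUnary lam (x 0F)
      apply⋆ (𝕘 ⊳̇)        x = evalUnary ρ (x 0F)

      eval-replace : ∀ {n} (s : Term (𝒮 ⋆) n) v →
                     ⟦ replace π σ lam ρ s ⟧ v ≈ eval apply⋆ s (λ x _ → v x)
      eval-replace (var x)                 v = Eq.refl
      eval-replace (node ⊥̂ args)          v = Eq.refl
      eval-replace (node ⊤̂ args)          v = Eq.refl
      eval-replace (node ∧̂ args)          v =
        apply-cong ∧̂ {λ h → ⟦ replace π σ lam ρ (args h) ⟧ v} {λ h → eval apply⋆ (args h) _}
          λ h → eval-replace (args h) v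
      eval-replace (node ∨̂ args)          v =
        apply-cong ∨̂ {λ h → ⟦ replace π σ lam ρ (args h) ⟧ v} {λ h → eval apply⋆ (args h) _}
          λ h → eval-replace (args h) v
      eval-replace (node (𝕗 (old f)) args) v = apply-cong (𝕗 f) λ h → eval-replace (args h) v
      eval-replace (node (𝕘 (old g)) args) v = apply-cong (𝕘 g) λ h → eval-replace (args h) v
      eval-replace (node (𝕗 ◇̇) args)      v = eval-[] π (eval-replace (args 0F) v)
      eval-replace (node (𝕘 □̇) args)      v = eval-[] σ (eval-replace (args 0F) v)
      eval-replace (node (𝕗 ⊲̇) args)      v = eval-[] lam (eval-replace (args 0F) v)
      eval-replace (node (𝕘 ⊳̇) args)      v = eval-[] ρ (eval-replace (args 0F) v)

-- The canonical extension as an interpretation of both signatures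

module _ {o ℓ} {𝒮 : Signature o} (A : DLE 𝒮 ℓ) (E : CanonicalExtension (DLE.bdl A)) where
  open Signature 𝒮
  private
    module A = DLE A
    module E = CanonicalExtension E
    Aδ = canonicalExtension A E
  open Canonical E hiding (A)

  canonical : Interpretation E 𝒮
  canonical = record
    { applyᴬ = apply A.algebra ; applyᶜ = apply Aδ ; op = op ; additive = additive
    ; ∧-apply = λ _ → refl ; ∨-apply = λ _ → refl }
    where
    op : ∀ c → Op (λ s h → childSign s c h) (apply A.algebra c) (apply Aδ c)
    op ⊥̂     = bot-op ⊕
    op ⊤̂     = bot-op ⊖
    op ∧̂     = join-op ⊖
    op ∨̂     = join-op ⊕
    op (𝕗 f) = σ-extension-op (ot-f f) (λ s h → actᵒ≡act {𝒮 = 𝒮} (ot-f f h) s) (A.⟦𝕗⟧ f)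
                 (A.𝕗-cong f) (A.𝕗-normal f)
    op (𝕘 g) = π-extension-op (ot-g g) (λ s h → actᵒ≡act {𝒮 = 𝒮} (ot-g g h) s) (A.⟦𝕘⟧ g)
                 (A.𝕘-cong g) (A.𝕘-normal g)
    additive : ∀ {s c} → Additivity s c →
               Additive s (λ s h → childSign s c h) (apply A.algebra c) (apply Aδ c)
    additive {s} ∧-additive = join-additive ⊖ s
    additive {s} ∨-additive = join-additive ⊕ s
    additive {c = 𝕗 f} f-additive =
      σ-extension-additive (ot-f f) (λ s h → actᵒ≡act {𝒮 = 𝒮} (ot-f f h) s) (A.⟦𝕗⟧ f)
        (A.𝕗-cong f) (A.𝕗-normal f)
    additive {c = 𝕘 g} g-additive =
      π-extension-additive (ot-g g) (λ s h → actᵒ≡act {𝒮 = 𝒮} (ot-g g h) s) (A.⟦𝕘⟧ g)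
        (A.𝕘-cong g) (A.𝕘-normal g)

  open Evaluation E canonical

  module _ (π σ lam ρ : Term 𝒮 1)
           (π⁺ : PositiveIn 0F π) (σ⁺ : PositiveIn 0F σ)
           (λ⁻ : NegativeIn 0F lam) (ρ⁻ : NegativeIn 0F ρ)
           (π-∨ : A.algebra ⊨ π [ var {n = 2} 0F ∨ᵗ var 1F ] ≼ π [ var 0F ] ∨ᵗ π [ var 1F ])
           (σ-∧ : A.algebra ⊨ σ [ var {n = 2} 0F ] ∧ᵗ σ [ var 1F ] ≼ σ [ var 0F ∧ᵗ var 1F ])
           (ρ-∨ : A.algebra ⊨ ρ [ var {n = 2} 0F ] ∧ᵗ ρ [ var 1F ] ≼ ρ [ var 0F ∨ᵗ var 1F ])
           (λ-∧ : A.algebra ⊨ lam [ var {n = 2} 0F ∧ᵗ var 1F ] ≼ lam [ var 0F ] ∨ᵗ lam [ var 1F ])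
           where

    private
      positive-op : ∀ t → PositiveIn 0F t → Op (λ s _ → s)
                      (λ a → evalUnary A.algebra t (a 0F)) (λ u → evalUnary Aδ t (u 0F))
      positive-op t t⁺ = unary-op t (λ _ _ → refl)
        λ s b → trans (leafSign-parity s b) (cong (λ p → actParity {𝒮 = 𝒮} p s) (t⁺ b))

      negative-op : ∀ t → NegativeIn 0F t → Op (λ s _ → opposite s)
                      (λ a → evalUnary A.algebra t (a 0F)) (λ u → evalUnary Aδ t (u 0F))
      negative-op t t⁻ = unary-op t (λ _ _ → refl)
        λ s b → trans (leafSign-parity s b) (cong (λ p → actParity {𝒮 = 𝒮} p s) (t⁻ b))

      unary-meets : ∀ t {χ F} (op : Op {1} χ (λ a → evalUnary A.algebra t (a 0F)) F) s →
        (∀ p q → meet s (evalUnary A.algebra t p) (evalUnary A.algebra t q) ⊑⟨ s ⟩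
                 evalUnary A.algebra t (meet (χ s 0F) p q)) →
        MeetPreserving s χ (λ a → evalUnary A.algebra t (a 0F))
      unary-meets t {χ} op s hyp 0F {p} {q} {r} x≤p x≤q off at =
        ⊑-trans (meet-greatest s x≤p x≤q) (⊑-trans (hyp (p 0F) (q 0F))
          (Op.mono op s {λ _ → meet (χ s 0F) (p 0F) (q 0F)} {r}
            λ { 0F → at _ (meet-lb₁ (χ s 0F)) (meet-lb₂ (χ s 0F)) }))

      value : ∀ t (θ : Term 𝒮 2) v → A.⟦ t [ θ ] ⟧ v A.≈ evalUnary A.algebra t (A.⟦ θ ⟧ v)
      value t θ v = eval-[] A.algebra applyᴬ-cong t {θ} {v} A.Eq.refl

      π-meets : MeetPreserving ⊖ (λ s _ → s) (λ a → evalUnary A.algebra π (a 0F))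
      π-meets = unary-meets π (positive-op π π⁺) ⊖ λ p q →
        let v = p ∷ᵛ q ∷ᵛ []ᵛ in turn ⊕
          (⊑-trans (≈⇒⊑ ⊕ (A.Eq.sym (value π (var 0F ∨ᵗ var 1F) v)))
          (⊑-trans ⟪ π-∨ v ⟫
            (join-least ⊕ (⊑-trans (≈⇒⊑ ⊕ (value π (var 0F) v)) (join-ub₁ ⊕))
                          (⊑-trans (≈⇒⊑ ⊕ (value π (var 1F) v)) (join-ub₂ ⊕)))))

      λ-meets : MeetPreserving ⊖ (λ s _ → opposite s) (λ a → evalUnary A.algebra lam (a 0F))
      λ-meets = unary-meets lam (negative-op lam λ⁻) ⊖ λ p q →
        let v = p ∷ᵛ q ∷ᵛ []ᵛ in turn ⊕
          (⊑-trans (≈⇒⊑ ⊕ (A.Eq.sym (value lam (var 0F ∧ᵗ var 1F) v)))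
          (⊑-trans ⟪ λ-∧ v ⟫
            (join-least ⊕ (⊑-trans (≈⇒⊑ ⊕ (value lam (var 0F) v)) (join-ub₁ ⊕))
                          (⊑-trans (≈⇒⊑ ⊕ (value lam (var 1F) v)) (join-ub₂ ⊕)))))

      σ-meets : MeetPreserving ⊕ (λ s _ → s) (λ a → evalUnary A.algebra σ (a 0F))
      σ-meets = unary-meets σ (positive-op σ σ⁺) ⊕ λ p q →
        let v = p ∷ᵛ q ∷ᵛ []ᵛ in
          ⊑-trans (meet-greatest ⊕
                     (⊑-trans (meet-lb₁ ⊕) (≈⇒⊑ ⊕ (A.Eq.sym (value σ (var 0F) v))))
                     (⊑-trans (meet-lb₂ ⊕) (≈⇒⊑ ⊕ (A.Eq.sym (value σ (var 1F) v)))))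
          (⊑-trans ⟪ σ-∧ v ⟫ (≈⇒⊑ ⊕ (value σ (var 0F ∧ᵗ var 1F) v)))

      ρ-meets : MeetPreserving ⊕ (λ s _ → opposite s) (λ a → evalUnary A.algebra ρ (a 0F))
      ρ-meets = unary-meets ρ (negative-op ρ ρ⁻) ⊕ λ p q →
        let v = p ∷ᵛ q ∷ᵛ []ᵛ in
          ⊑-trans (meet-greatest ⊕
                     (⊑-trans (meet-lb₁ ⊕) (≈⇒⊑ ⊕ (A.Eq.sym (value ρ (var 0F) v))))
                     (⊑-trans (meet-lb₂ ⊕) (≈⇒⊑ ⊕ (A.Eq.sym (value ρ (var 1F) v)))))
          (⊑-trans ⟪ ρ-∨ v ⟫ (≈⇒⊑ ⊕ (value ρ (var 0F ∨ᵗ var 1F) v)))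

      unary-additive : ∀ {χ f F} (op : Op {1} χ f F) s →
                       MeetPreserving (opposite s) χ f → Additive s χ f F
      unary-additive op s meets = record { meets = meets ; approx = unary-approximable op s meets }

    -- The new connectives are interpreted by evaluating the four terms in `A` and in `Aδ`. The four
    -- assumed inequalities enter in their `additive` clauses.
    canonical⋆ : Interpretation E (𝒮 ⋆)
    canonical⋆ = record
      { applyᴬ = apply⋆ᴬ ; applyᶜ = apply⋆ᶜ ; op = op ; additive = additive
      ; ∧-apply = λ _ → refl ; ∨-apply = λ _ → refl }
      where
      apply⋆ᴬ = apply⋆ A.algebra applyᴬ-cong π σ lam ρ
      apply⋆ᶜ = apply⋆ Aδ applyᶜ-cong π σ lam ρ
      op : ∀ c → Op (λ s h → childSign s c h) (apply⋆ᴬ c) (apply⋆ᶜ c)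
      op ⊥̂           = bot-op ⊕
      op ⊤̂           = bot-op ⊖
      op ∧̂           = join-op ⊖
      op ∨̂           = join-op ⊕
      op (𝕗 (old f)) = σ-extension-op (ot-f f) (λ s h → actᵒ≡act {𝒮 = 𝒮 ⋆} (ot-f f h) s) (A.⟦𝕗⟧ f)
                         (A.𝕗-cong f) (A.𝕗-normal f)
      op (𝕘 (old g)) = π-extension-op (ot-g g) (λ s h → actᵒ≡act {𝒮 = 𝒮 ⋆} (ot-g g h) s) (A.⟦𝕘⟧ g)
                         (A.𝕘-cong g) (A.𝕘-normal g)
      op (𝕗 ◇̇)      = positive-op π π⁺
      op (𝕘 □̇)      = positive-op σ σ⁺
      op (𝕗 ⊲̇)      = negative-op lam λ⁻
      op (𝕘 ⊳̇)      = negative-op ρ ρ⁻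
      additive : ∀ {s c} → Additivity s c →
                 Additive s (λ s h → childSign s c h) (apply⋆ᴬ c) (apply⋆ᶜ c)
      additive {s} ∧-additive = join-additive ⊖ s
      additive {s} ∨-additive = join-additive ⊕ s
      additive {c = 𝕗 (old f)} f-additive =
        σ-extension-additive (ot-f f) (λ s h → actᵒ≡act {𝒮 = 𝒮 ⋆} (ot-f f h) s) (A.⟦𝕗⟧ f)
          (A.𝕗-cong f) (A.𝕗-normal f)
      additive {c = 𝕘 (old g)} g-additive =
        π-extension-additive (ot-g g) (λ s h → actᵒ≡act {𝒮 = 𝒮 ⋆} (ot-g g h) s) (A.⟦𝕘⟧ g)
          (A.𝕘-cong g) (A.𝕘-normal g)
      additive {c = 𝕗 ◇̇} f-additive = unary-additive (positive-op π π⁺) ⊕ π-meets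
      additive {c = 𝕗 ⊲̇} f-additive = unary-additive (negative-op lam λ⁻) ⊕ λ-meets
      additive {c = 𝕘 □̇} g-additive = unary-additive (positive-op σ σ⁺) ⊖ σ-meets
      additive {c = 𝕘 ⊳̇} g-additive = unary-additive (negative-op ρ ρ⁻) ⊖ ρ-meets

-- Inductive terms

module _ {o} {𝒮 : Signature o} {n : ℕ} where

  branch? : ∀ {p x} (t : Term 𝒮 n) {P : Branch x t → Set p} → (∀ b → Dec (P b)) → Dec (∃ P)
  branch? {x = x} (var y) P? with x ≟ y
  ... | yes refl = map′ (leaf ,_) (λ { (leaf , p) → p }) (P? leaf)
  ... | no x≢y   = no λ { (leaf , _) → x≢y refl }
  branch? (node c args) P? =
    map′ (λ (j , b , p) → step j b , p) (λ { (step j b , p) → j , b , p })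
         (any? λ j → branch? (args j) (P? ∘ step j))

  SRR? : ∀ s (c : Label 𝒮) → Dec (SRR s c)
  SRR? ⊕ ⊥̂     = no λ ()
  SRR? ⊕ ⊤̂     = no λ ()
  SRR? ⊕ ∧̂     = no λ ()
  SRR? ⊕ ∨̂     = yes +∨
  SRR? ⊕ (𝕗 f) = no λ ()
  SRR? ⊕ (𝕘 g) = map′ +g (λ { (+g p) → p }) (2 ℕₚ.≤? Signature.ar-g 𝒮 g)
  SRR? ⊖ ⊥̂     = no λ ()
  SRR? ⊖ ⊤̂     = no λ ()
  SRR? ⊖ ∧̂     = yes -∧
  SRR? ⊖ ∨̂     = no λ ()
  SRR? ⊖ (𝕗 f) = map′ -f (λ { (-f p) → p }) (2 ℕₚ.≤? Signature.ar-f 𝒮 f)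
  SRR? ⊖ (𝕘 g) = no λ ()

  -- The part of the order on variables that a branch really enforces; unlike an arbitrary `Ω` it
  -- can be decided.
  Needs : ∀ s {t : Term 𝒮 n} {x} → Fin n → Branch x t → Set o
  Needs s k leaf = Lift o ⊥
    where open import Data.Empty using (⊥)
  Needs s k (step {c} {args} j b) =
    (SRR s c × ∃ λ h → h ≢ j × Branch k (args h)) ⊎ Needs (childSign s c j) k b

  needs? : ∀ s {t : Term 𝒮 n} {x} k (b : Branch x t) → Dec (Needs s k b)
  needs? s k leaf = no λ ()
  needs? s k (step {c} {args} j b) =
    (SRR? s c ×-dec any? λ h → ¬? (h ≟ j) ×-dec
       map′ proj₁ (λ b → b , tt) (branch? (args h) λ _ → yes tt))
    ⊎-dec needs? (childSign s c j) k b
    where open import Data.Unit.Base using (tt)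

  critical? : ∀ (ε : Vector OrderType n) s x → Dec (Critical {𝒮 = 𝒮} ε s x)
  critical? ε ⊕ x with ε x in eq
  ... | 𝟙 = yes (+crit eq)
  ... | ∂ = no λ { (+crit eq′) → 𝟙≢∂ (trans (sym eq′) eq) }
    where
    𝟙≢∂ : 𝟙 ≢ ∂
    𝟙≢∂ ()
  critical? ε ⊖ x with ε x in eq
  ... | ∂ = yes (-crit eq)
  ... | 𝟙 = no λ { (-crit eq′) → 𝟙≢∂ (trans (sym eq) eq′) }
    where
    𝟙≢∂ : 𝟙 ≢ ∂
    𝟙≢∂ ()

  critical-flip : ∀ {ε : Vector OrderType n} {s x} →
                  Critical {𝒮 = 𝒮} (flipᵒ ∘ ε) s x → ¬ Critical {𝒮 = 𝒮} ε s x
  critical-flip {ε} {x = x} (+crit p) (+crit q) with ε x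
  critical-flip (+crit ()) (+crit refl) | 𝟙
  critical-flip {ε} {x = x} (-crit p) (-crit q) with ε x
  critical-flip (-crit ()) (-crit refl) | ∂

  Depends : Vector OrderType n → Sign → Term 𝒮 n → Rel (Fin n) o
  Depends ε s t k x =
    ∃ λ (b : Branch x t) → Critical {𝒮 = 𝒮} ε (leafSign s b) x × Needs s k b

  depends? : ∀ ε s t k x → Dec (Depends ε s t k x)
  depends? ε s t k x = branch? t λ b → critical? ε (leafSign s b) x ×-dec needs? s k b

  module _ {Ω : Rel (Fin n) 0ℓ} {ε : Vector OrderType n} where

    needs-Ω : ∀ s {t : Term 𝒮 n} {x} (b : Branch x t) → SRRCondition Ω ε s b →
              ∀ k → Needs s k b → Ω k x
    needs-Ω s (step j b) (srr , _) k (inj₁ (isSRR , h , h≢j , occ)) = proj₂ (srr isSRR h h≢j) k occ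
    needs-Ω s (step j b) (_ , rest) k (inj₂ q) = needs-Ω _ b rest k q

    depends-Ω : ∀ {s t} → InductiveTree Ω ε s t → ∀ {k x} → Depends ε s t k x → Ω k x
    depends-Ω ind (b , crit , q) = needs-Ω _ b (proj₂ (ind b crit)) _ q

    module _ {R : Rel (Fin n) 0ℓ} where

      srr-restrict : ∀ s {t : Term 𝒮 n} {x} (b : Branch x t) →
                     (∀ k → Needs s k b → R k x) → SRRCondition Ω ε s b → SRRCondition R ε s b
      srr-restrict s leaf _ _ = _
      srr-restrict s (step j b) needs (srr , rest) =
        (λ isSRR h h≢j → proj₁ (srr isSRR h h≢j) ,
                         λ k occ → needs k (inj₁ (isSRR , h , h≢j , occ))) ,
        srr-restrict _ b (λ k → needs k ∘ inj₂) rest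

      -- The inductive condition consults the order only at pairs in `Depends`.
      inductive-restrict : ∀ {s t} → InductiveTree Ω ε s t →
                           (∀ {k x} → Depends ε s t k x → R k x) → InductiveTree R ε s t
      inductive-restrict ind dep b crit =
        proj₁ (ind b crit) , srr-restrict _ b (λ k q → dep (b , crit , q)) (proj₂ (ind b crit))

  Noncritical : Vector OrderType n → Sign → Term 𝒮 n → Set o
  Noncritical ε s t = ∀ x (b : Branch x t) → ¬ Critical {𝒮 = 𝒮} ε (leafSign s b) x

  module _ {R : Rel (Fin n) 0ℓ} (ε : Vector OrderType n) where

    -- Sorted by how meets pass through the root: an adjoint node is itself a meet and admits
    -- critical leaves in every argument, while a residual one preserves meets in one argument at a
    -- time. In `residual`, joins are preserved at sign `r`, hence meets at `s`.
    data PIA : Sign → Term 𝒮 n → Set o where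
      noncritical : ∀ {s t} → Noncritical ε s t → PIA s t
      critical    : ∀ {s x} → Critical {𝒮 = 𝒮} ε s x → PIA s (var x)
      adjoint     : ∀ {s c args} → IsMeet s c → (∀ h → PIA (childSign s c h) (args h)) →
                    PIA s (node c args)
      residual    : ∀ {r s c args} → Additivity r c → s ≡ opposite r → ∀ j →
                    PIA (childSign s c j) (args j) →
                    (∀ h → h ≢ j → Noncritical ε (childSign s c h) (args h)) →
                    (∀ h → h ≢ j → ∀ k → Branch k (args h) → ∀ {x} (b : Branch x (args j)) →
                       Critical {𝒮 = 𝒮} ε (leafSign (childSign s c j) b) x → R k x) →
                    PIA s (node c args)

    PIABranches : Sign → Term 𝒮 n → Set o
    PIABranches s t = ∀ {x} (b : Branch x t) → Critical {𝒮 = 𝒮} ε (leafSign s b) x →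
                      All PIANode (nodes s b) × SRRCondition R ε s b

    toPIA : ∀ s t → PIABranches s t → PIA s t

    private
      children : ∀ {s c args} → PIABranches s (node c args) → ∀ h → PIA (childSign s c h) (args h)
      children {args = args} branches h = toPIA _ (args h) λ b crit →
        let nodesPIA , srr = branches (step h b) crit in tailPIA nodesPIA , proj₂ srr
        where
        tailPIA : ∀ {x xs} → All PIANode (x ∷ xs) → All PIANode xs
        tailPIA (_ ∷ ps) = ps

      toResidual : ∀ r s c args → Additivity r c → s ≡ opposite r →
                   (∀ {h j} → h ≢ j → SRR s c) → PIABranches s (node c args) → PIA s (node c args)
      toResidual r s c args add s≡ srr branches
        with any? (λ j → any? λ x → branch? {x = x} (args j) λ b →
                           critical? ε (leafSign (childSign s c j) b) x)
      ... | no none = noncritical λ { x (step j b) crit → none (j , x , b , crit) }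
      -- One critical branch through `j` makes all other arguments noncritical, by the SRR
      -- condition. Another argument exists only if the arity is at least two, and then the node is
      -- SRR.
      ... | yes (j , _ , b , crit) = residual add s≡ j (children branches j)
        (λ h h≢j x b′ crit′ → critical-flip
          (proj₁ (proj₁ (proj₂ (branches (step j b) crit)) (srr h≢j) h h≢j) b′) crit′)
        (λ h h≢j k occ b′ crit′ →
          proj₂ (proj₁ (proj₂ (branches (step j b′) crit′)) (srr h≢j) h h≢j) k occ)

      distinct⇒2≤ : ∀ {m} {h j : Fin m} → h ≢ j → 2 ℕ.≤ m
      distinct⇒2≤ {1} {0F} {0F} h≢j         = ⊥-elim (h≢j refl)
      distinct⇒2≤ {ℕ.suc (ℕ.suc m)} _ = ℕ.s≤s (ℕ.s≤s ℕ.z≤n)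

    toPIA s (var x) branches with critical? ε s x
    ... | yes crit = critical crit
    ... | no ¬crit = noncritical λ { _ leaf crit → ¬crit crit }
    toPIA s (node ⊥̂ args) branches = noncritical λ { _ (step () _) _ }
    toPIA s (node ⊤̂ args) branches = noncritical λ { _ (step () _) _ }
    toPIA ⊕ (node ∧̂ args) branches = adjoint +∧ (children branches)
    toPIA ⊖ (node ∧̂ args) branches =
      toResidual ⊕ ⊖ ∧̂ args ∧-additive refl (λ _ → -∧) branches
    toPIA ⊕ (node ∨̂ args) branches =
      toResidual ⊖ ⊕ ∨̂ args ∨-additive refl (λ _ → +∨) branches
    toPIA ⊖ (node ∨̂ args) branches = adjoint -∨ (children branches)
    -- A critical branch would contain a positive `f`, which is not a PIA node.
    toPIA ⊕ (node (𝕗 f) args) branches = noncritical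
      λ { _ b@(step _ _) crit → impossible (proj₁ (branches b crit)) }
      where
      impossible : ∀ {xs} → ¬ All PIANode ((⊕ , 𝕗 f) ∷ xs)
      impossible (inj₁ () ∷ _)
      impossible (inj₂ () ∷ _)
    toPIA ⊖ (node (𝕗 f) args) branches =
      toResidual ⊕ ⊖ (𝕗 f) args f-additive refl (λ h≢j → -f (distinct⇒2≤ h≢j)) branches
    toPIA ⊕ (node (𝕘 g) args) branches =
      toResidual ⊖ ⊕ (𝕘 g) args g-additive refl (λ h≢j → +g (distinct⇒2≤ h≢j)) branches
    toPIA ⊖ (node (𝕘 g) args) branches = noncritical
      λ { _ b@(step _ _) crit → impossible (proj₁ (branches b crit)) }
      where
      impossible : ∀ {xs} → ¬ All PIANode ((⊖ , 𝕘 g) ∷ xs)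
      impossible (inj₁ () ∷ _)
      impossible (inj₂ () ∷ _)

-- Solving PIA inequalities in A

module ConstraintSystems {ℓ} {L : BDL ℓ} (E : CanonicalExtension L)
                         {o} {𝒮 : Signature o} (I : Interpretation E 𝒮)
                         {n} (ε : Vector OrderType n) (R : Rel (Fin n) 0ℓ) where
  open Canonical E
  open Interpretation I
  open Evaluation E I

  sg : Fin n → Sign
  sg x = act (ε x) ⊕

  critical-sign : ∀ {s x} → Critical {𝒮 = 𝒮} ε s x → s ≡ sg x
  critical-sign {x = x} (+crit p) with ε x
  critical-sign (+crit refl) | 𝟙 = refl
  critical-sign {x = x} (-crit p) with ε x
  critical-sign (-crit refl) | ∂ = refl

  noncritical-sign : ∀ s x → ¬ Critical {𝒮 = 𝒮} ε s x → s ≡ opposite (sg x)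
  noncritical-sign ⊕ x ¬crit with ε x in eq
  ... | 𝟙 = ⊥-elim (¬crit (+crit eq))
  ... | ∂ = refl
  noncritical-sign ⊖ x ¬crit with ε x in eq
  ... | 𝟙 = refl
  ... | ∂ = ⊥-elim (¬crit (-crit eq))

  infix 4 _⊴_

  _⊴_ : Rel (Vector A n) ℓ
  b ⊴ c = ∀ x → b x ⊑⟨ sg x ⟩ c x

  bots : Vector A n
  bots x = bot (sg x)

  joins meets : Vector A n → Vector A n → Vector A n
  joins b c x = join (sg x) (b x) (c x)
  meets b c x = meet (sg x) (b x) (c x)

  private
    pick : ∀ {p} {P : Set p} → Dec P → A → A → A
    pick (yes _) a _ = a
    pick (no _)  _ a = a

  -- Critical leaves are evaluated by b, the others by c.
  pair : Vector A n → Vector A n → Sign → Fin n → A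
  pair b c s x = pick (critical? {𝒮 = 𝒮} ε s x) (b x) (c x)

  evalPair : Sign → Term 𝒮 n → Vector A n → Vector A n → A
  evalPair s t b c = evalᴬ t λ x br → pair b c (leafSign s br) x

  pair-critical : ∀ b c {s x} → Critical {𝒮 = 𝒮} ε s x → pair b c s x ≡ b x
  pair-critical b c {s} {x} crit with critical? {𝒮 = 𝒮} ε s x
  ... | yes _    = refl
  ... | no ¬crit = ⊥-elim (¬crit crit)

  pair-mono : ∀ b b′ c c′ s x → (Critical {𝒮 = 𝒮} ε s x → b x ⊑⟨ sg x ⟩ b′ x) →
              (¬ Critical {𝒮 = 𝒮} ε s x → c′ x ⊑⟨ sg x ⟩ c x) → pair b c s x ⊑⟨ s ⟩ pair b′ c′ s x
  pair-mono b b′ c c′ s x p q with critical? {𝒮 = 𝒮} ε s x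
  ... | yes crit = subst (b x ⊑⟨_⟩ b′ x) (sym (critical-sign crit)) (p crit)
  ... | no ¬crit = subst (c x ⊑⟨_⟩ c′ x) (sym (noncritical-sign s x ¬crit)) (turn _ (q ¬crit))

  -- The new critical value is covered either by `b` alone or by `b` and `b′` only together. In the
  -- second case the side values next to `i` have to be small enough for `c′` as well.
  Mixed : (b c b′ c′ x z : Vector A n) → Fin n → Set ℓ
  Mixed b c b′ c′ x z i =
    b i ⊑⟨ sg i ⟩ x i ⊎ (meet (sg i) (b i) (b′ i) ⊑⟨ sg i ⟩ x i × ∀ j → R j i → z j ⊑⟨ sg j ⟩ c′ j)

  module _ {b c b′ c′ x z : Vector A n} (z⊴c : z ⊴ c) (mixed : ∀ i → Mixed b c b′ c′ x z i) where

    private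
      UsesSecond : Sign → Term 𝒮 n → Set (o ⊔ ℓ)
      UsesSecond s t = ∃ λ i → ∃ λ (br : Branch i t) →
        Critical {𝒮 = 𝒮} ε (leafSign s br) i × ∀ j → R j i → z j ⊑⟨ sg j ⟩ c′ j

      noncritical-first : ∀ s t → Noncritical ε s t → evalPair s t b c ⊑⟨ s ⟩ evalPair s t x z
      noncritical-first s t nc = evalᴬ-mono s t λ i br →
        pair-mono b x c z (leafSign s br) i (λ crit → ⊥-elim (nc i br crit)) (λ _ → z⊴c i)

      noncritical-second : ∀ s t → Noncritical ε s t →
                           (∀ k → Branch k t → z k ⊑⟨ sg k ⟩ c′ k) →
                           evalPair s t b′ c′ ⊑⟨ s ⟩ evalPair s t x z
      noncritical-second s t nc z≤c′ = evalᴬ-mono s t λ i br →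
        pair-mono b′ x c′ z (leafSign s br) i (λ crit → ⊥-elim (nc i br crit)) (λ _ → z≤c′ i br)

    -- The side arguments of a residual node are only compared with their
    -- values under c′ when some critical leaf of its main argument really
    -- needs b′; R then controls the variables of the side arguments.
    PIA-mixed : ∀ {s t} → PIA {R = R} ε s t →
      (evalPair s t b c ⊑⟨ s ⟩ evalPair s t x z ⊎ UsesSecond s t) ×
      (∀ {y} → y ⊑⟨ s ⟩ evalPair s t b c → y ⊑⟨ s ⟩ evalPair s t b′ c′ → y ⊑⟨ s ⟩ evalPair s t x z)
    PIA-mixed {s} {t} (noncritical nc) =
      inj₁ (noncritical-first s t nc) , λ p _ → ⊑-trans p (noncritical-first s t nc)
    PIA-mixed {s} {var i} (critical crit) with mixed i
    ... | inj₁ b≤x = inj₁ leaf≤ , λ p _ → ⊑-trans p leaf≤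
      where
      leaf≤ : pair b c s i ⊑⟨ s ⟩ pair x z s i
      leaf≤ = pair-mono b x c z s i (λ _ → b≤x) (λ ¬crit → ⊥-elim (¬crit crit))
    ... | inj₂ (meet≤x , second) = inj₂ (i , leaf , crit , second) , λ {y} p q →
      subst₂ (λ r w → y ⊑⟨ r ⟩ w) (sym s≡) (sym (pair-critical x z crit))
        (⊑-trans (meet-greatest (sg i) (at (pair-critical b c crit) p)
                                       (at (pair-critical b′ c′ crit) q)) meet≤x)
      where
      s≡ = critical-sign crit
      at : ∀ {y v w} → v ≡ w → y ⊑⟨ s ⟩ v → y ⊑⟨ sg i ⟩ w
      at {y} eq p = subst₂ (λ r w → y ⊑⟨ r ⟩ w) s≡ eq p
    PIA-mixed {s} {node c₀ args} (adjoint isMeet pias) =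
      plain isMeet (λ h → proj₁ (PIA-mixed (pias h))) ,
      λ p q → meet-upper isMeet λ h →
        proj₂ (PIA-mixed (pias h)) (meet-lower isMeet p h) (meet-lower isMeet q h)
      where
      plain : ∀ {s c₀ args} → IsMeet s c₀ →
              (∀ h → evalPair (childSign s c₀ h) (args h) b c ⊑⟨ childSign s c₀ h ⟩
                     evalPair (childSign s c₀ h) (args h) x z ⊎
                     UsesSecond (childSign s c₀ h) (args h)) →
              evalPair s (node c₀ args) b c ⊑⟨ s ⟩ evalPair s (node c₀ args) x z ⊎
              UsesSecond s (node c₀ args)
      plain {s} {c₀} {args} m first = combine m (both m first)
        where
        both : ∀ {p q} {P : Fin (arity c₀) → Set p} {Q : Fin (arity c₀) → Set q} →
               IsMeet s c₀ → (∀ h → P h ⊎ Q h) → (∀ h → P h) ⊎ ∃ Q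
        both m f with any? {P = λ h → ∃ λ q → f h ≡ inj₂ q} (λ h → isInj₂ (f h))
          where
          isInj₂ : ∀ {p q} {P : Set p} {Q : Set q} (w : P ⊎ Q) → Dec (∃ λ q → w ≡ inj₂ q)
          isInj₂ (inj₁ _) = no λ ()
          isInj₂ (inj₂ q) = yes (q , refl)
        ... | yes (h , q , _) = inj₂ (h , q)
        ... | no none = inj₁ λ h → fromInj₁ (f h) (λ q eq → none (h , q , eq))
          where
          fromInj₁ : ∀ {p q} {P : Set p} {Q : Set q} (w : P ⊎ Q) → (∀ q → w ≢ inj₂ q) → P
          fromInj₁ (inj₁ p) _  = p
          fromInj₁ (inj₂ q) ne = ⊥-elim (ne q refl)
        combine : IsMeet s c₀ → (∀ h → _) ⊎ ∃ (λ h → UsesSecond (childSign s c₀ h) (args h)) → _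
        combine m (inj₁ all) = inj₁ (Op.mono (op c₀) s all)
        combine m (inj₂ (h , i , br , crit , second)) = inj₂ (i , step h br , crit , second)
    PIA-mixed {s} {node c₀ args} (residual {r} add refl j pia nc deps) with PIA-mixed pia
    ... | inj₁ p , _ = inj₁ whole , λ q _ → ⊑-trans q whole
      where
      pointwise : ∀ h → evalPair (childSign s c₀ h) (args h) b c ⊑⟨ childSign s c₀ h ⟩
                        evalPair (childSign s c₀ h) (args h) x z
      pointwise h with h ≟ j
      ... | yes refl = p
      ... | no h≢j   = noncritical-first _ (args h) (nc h h≢j)
      whole : evalPair s (node c₀ args) b c ⊑⟨ s ⟩ evalPair s (node c₀ args) x z
      whole = Op.mono (op c₀) s pointwise
    ... | inj₂ (i , br , crit , second) , both =
      inj₂ (i , step j br , crit , second) ,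
      λ p q → Additive.meets (additive add) j p q
        (λ h h≢j → noncritical-first _ (args h) (nc h h≢j) ,
                   noncritical-second _ (args h) (nc h h≢j)
                     (λ k occ → second k (deps h h≢j k occ br crit)))
        (λ y → both)

  -- Systems of PIA inequalities and their approximate solutions

  OpenAbove : Vector C n → Vector C n → Set ℓ
  OpenAbove u o = ∀ x → Closed (opposite (sg x)) (o x) × u x ≤⟨ sg x ⟩ o x

  infix 4 _≪_

  _≪_ : Vector A n → Vector C n → Set ℓ
  b ≪ o = ∀ x → ι (b x) ≤⟨ sg x ⟩ o x

  bots≪ : ∀ {o} → bots ≪ o
  bots≪ x = ι-bot-least (sg x)

  joins≪ : ∀ {b c o} → b ≪ o → c ≪ o → joins b c ≪ o
  joins≪ p q x = ι-join-least (sg x) (p x) (q x)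

  -- `u` is the meet of the open tuples above it, so these conditions place the filtered meet of `B`
  -- below `u`.
  record Approximates (u : Vector C n) (B : Pred (Vector A n) ℓ) : Set ℓ where
    field
      directed : ∀ {b c} → B b → B c → ∃ λ d → B d × d ⊴ b × d ⊴ c
      below    : ∀ {o} → OpenAbove u o → ∃ λ b → B b × b ≪ o

  -- Sat b c: certain PIA inequalities hold when the critical leaves are
  -- evaluated by b and the others by c.
  record System (u : Vector C n) : Set (lsuc ℓ) where
    field
      Sat    : Vector A n → Vector A n → Set ℓ
      mix    : ∀ {b c b′ c′ x z} → Sat b c → Sat b′ c′ → z ⊴ c →
               (∀ i → Mixed b c b′ c′ x z i) → Sat x z
      approx : ∀ {o B} → OpenAbove u o → Approximates u B →
               ∃₂ λ b c → b ≪ o × B c × Sat b c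

    sat-mono : ∀ {b c x z} → Sat b c → b ⊴ x → z ⊴ c → Sat x z
    sat-mono sat p q = mix sat sat q (λ i → inj₁ (p i))

  module _ {u : Vector C n} where

    replaceTop : Fin n → C → Vector C n
    replaceTop x o = replaceAt (λ y → ι (bot (opposite (sg y)))) x o

    replaceTop-open : ∀ {x o} → Closed (opposite (sg x)) o → u x ≤⟨ sg x ⟩ o →
                      OpenAbove u (replaceTop x o)
    replaceTop-open oc u≤o = replaceAt-elim
      (λ y w → Closed (opposite (sg y)) w × u y ≤⟨ sg y ⟩ w) (oc , u≤o)
      (λ y _ → ι-closed _ , ι-top-greatest (sg y))

    approximates-nonempty : ∀ {B} → Approximates u B → ∃ B
    approximates-nonempty approx =
      let b , Bb , _ = Approximates.below approx {λ y → ι (bot (opposite (sg y)))}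
                         (λ y → ι-closed _ , ι-top-greatest (sg y))
      in b , Bb

    trivialSystem : System u
    trivialSystem = record
      { Sat = λ _ _ → Unit ; mix = λ _ _ _ _ → _
      ; approx = λ _ approx → let c , Bc = approximates-nonempty approx in bots , c , bots≪ , Bc , _ }

    productSystem : ∀ {m} → (Fin m → System u) → System u
    productSystem systems = record
      { Sat = λ b c → ∀ h → System.Sat (systems h) b c
      ; mix = λ sat sat′ z⊴c mixed h → System.mix (systems h) (sat h) (sat′ h) z⊴c mixed
      ; approx = λ {o} {B} open-o approx →
          let c₀ , Bc₀ = approximates-nonempty approx
              each = λ h → System.approx (systems h) open-o approx
              -- The pairs found for the single systems are merged by raising `b` to a join and
              -- lowering `c` within `B`.
              (b , c , b≪o , Bc) , bound = finite-upper-bound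
                {I = ∃₂ λ b c → b ≪ o × B c}
                (λ (b , c , _) (b′ , c′ , _) → b ⊴ b′ × c′ ⊴ c)
                (λ (p , q) (p′ , q′) → (λ x → ⊑-trans (p x) (p′ x)) , (λ x → ⊑-trans (q′ x) (q x)))
                (bots , c₀ , bots≪ , Bc₀)
                (λ (b , c , b≪o , Bc) (b′ , c′ , b′≪o , Bc′) →
                  let d , Bd , d⊴c , d⊴c′ = Approximates.directed approx Bc Bc′
                  in (joins b b′ , d , joins≪ b≪o b′≪o , Bd) ,
                     ((λ x → join-ub₁ (sg x)) , d⊴c) , ((λ x → join-ub₂ (sg x)) , d⊴c′))
                (λ h → let b , c , b≪o , Bc , _ = each h in b , c , b≪o , Bc)
          in b , c , b≪o , Bc , λ h → let _ , _ , _ , _ , sat = each h in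
               System.sat-mono (systems h) sat (proj₁ (bound h)) (proj₂ (bound h))
      }

    -- The pairs with `b ≪ o` and `c` in `B` are directed and approximate `u` at every leaf. By
    -- `eval-esakia` the join of their values is above `k`, and compactness picks one pair.
    constraintSystem : ∀ {s t k} → PIA {R = R} ε s t → Closed s k → k ≤⟨ s ⟩ evalᶜ t (λ x _ → u x) →
                       System u
    constraintSystem {s} {t} {k} pia kc k≤t = record
      { Sat = λ b c → k ≤⟨ s ⟩ ι (evalPair s t b c)
      ; mix = λ sat sat′ z⊴c mixed →
          ≤⟨⟩-trans (ι-meet-greatest s sat sat′)
            (ι-mono s (proj₂ (PIA-mixed z⊴c mixed pia) (meet-lb₁ s) (meet-lb₂ s)))
      ; approx = approx
      }
      where
      approx : ∀ {o B} → OpenAbove u o → Approximates u B →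
               ∃₂ λ b c → b ≪ o × B c × k ≤⟨ s ⟩ ι (evalPair s t b c)
      approx {o} {B} open-o approxB =
        let _ , ((b , c , b≪o , Bc) , eq) , k≤ = compact s {T = λ a → ∃ λ j → evalᴬ t (w j) ≡ a} kc
              ((_ , j₀ , refl) , λ { (i , refl) (j , refl) →
                let l , i≼l , j≼l = directed i j
                in _ , (l , refl) , evalᴬ-mono s t (λ x br → i≼l x (leafSign s br))
                                  , evalᴬ-mono s t (λ x br → j≼l x (leafSign s br)) })
              (λ X ub → ≤⟨⟩-trans k≤t
                (eval-esakia s t w j₀
                  (λ i j → let l , i≼l , j≼l = directed i j
                           in l , (λ x br → i≼l x (leafSign s br)) , (λ x br → j≼l x (leafSign s br)))
                  (λ x br Y ub′ → leaf-below (leafSign s br) x Y ub′)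
                  (λ j → ub _ (j , refl))))
        in b , c , b≪o , Bc , ≤⟨⟩-trans k≤ (≤⟨⟩-reflexive s (cong ι (sym eq)))
        where
        J : Set ℓ
        J = ∃₂ λ b c → b ≪ o × B c
        value : J → Sign → Fin n → A
        value (b , c , _) = pair b c
        w : J → ∀ x → Branch x t → A
        w j x br = value j (leafSign s br) x
        c₀ = proj₁ (approximates-nonempty approxB)
        Bc₀ = proj₂ (approximates-nonempty approxB)
        j₀ : J
        j₀ = bots , c₀ , bots≪ , Bc₀
        directed : ∀ (i j : J) → ∃ λ l → (∀ x r → value i r x ⊑⟨ r ⟩ value l r x) ×
                                         (∀ x r → value j r x ⊑⟨ r ⟩ value l r x)
        directed (b , c , b≪o , Bc) (b′ , c′ , b′≪o , Bc′) =
          let d , Bd , d⊴c , d⊴c′ = Approximates.directed approxB Bc Bc′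
          in (joins b b′ , d , joins≪ b≪o b′≪o , Bd) ,
             (λ x r → pair-mono b (joins b b′) c d r x (λ _ → join-ub₁ (sg x)) (λ _ → d⊴c x)) ,
             (λ x r → pair-mono b′ (joins b b′) c′ d r x (λ _ → join-ub₂ (sg x)) (λ _ → d⊴c′ x))
        leaf-below : ∀ r x Y → (∀ j → ι (value j r x) ≤⟨ r ⟩ Y) → u x ≤⟨ r ⟩ Y
        leaf-below r x Y ub with critical? {𝒮 = 𝒮} ε r x | ub
        -- `u x` is below the open element `o x`, a join of elements `a` of `A`; each `a` is
        -- realised by a tuple with bottoms elsewhere.
        ... | yes crit | ub = subst (u x ≤⟨_⟩ Y) (sym r≡) (≤⟨⟩-trans (proj₂ (open-o x))
          (unturn (sg x) (proj₁ (open-o x) Y λ a o≤a → turn (sg x)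
            (subst₂ (λ q v → ι v ≤⟨ q ⟩ Y) r≡ (updateAt-updates x bots)
              (ub (replaceAt bots x a , c₀ ,
                   replaceAt-elim (λ y v → ι v ≤⟨ sg y ⟩ o y) (unturn (sg x) o≤a) (λ y _ → bots≪ {o} y) ,
                   Bc₀))))))
          where r≡ = critical-sign crit
        -- `u x` is the meet of the open elements above it, and below each of them lies the
        -- `x`-coordinate of a member of `B`.
        ... | no ¬crit | ub = subst (u x ≤⟨_⟩ Y) (sym r≡) (turn (sg x) (codense (sg x) λ o′ o′c u≤o′ →
          let c , Bc , c≪ = Approximates.below approxB (replaceTop-open o′c u≤o′)
          in ≤⟨⟩-trans
               (unturn (sg x) (subst (ι (c x) ≤⟨_⟩ Y) r≡ (ub (bots , c , bots≪ , Bc))))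
               (subst (ι (c x) ≤⟨ sg x ⟩_) (updateAt-updates x _) (c≪ x))))
          where r≡ = noncritical-sign r x ¬crit

  -- Chains of dependencies and the diagonal solution

  Chain : ℕ → Fin n → Set
  Chain ℕ.zero    j = Unit
  Chain (ℕ.suc m) j = ∃ λ i → R j i × Chain m i

  module _ (R? : ∀ j i → Dec (R j i)) where

    chain? : ∀ m j → Dec (Chain m j)
    chain? ℕ.zero    j = yes _
    chain? (ℕ.suc m) j = any? λ i → R? j i ×-dec chain? m i

    -- A strict partial order on a finite set is noetherian. By recursion along it, the bound for
    -- `j` is one more than a bound for all `R`-successors of `j`.
    chains-bounded : ∀ {Ω : Rel (Fin n) 0ℓ} → (∀ {j i} → R j i → Ω j i) →
                     Irreflexive _≡_ Ω → Transitive Ω → ∃ λ N → ∀ j → ¬ Chain N j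
    chains-bounded {Ω} R⊆Ω irrefl Ω-trans =
      let N , ≤N = maximum λ j → proj₁ (from j (spo-noetherian isSPO j))
      in N , λ j → proj₂ (from j (spo-noetherian isSPO j)) N (≤N j)
      where
      isSPO : IsStrictPartialOrder _≡_ Ω
      isSPO = record { isEquivalence = isEquivalence ; irrefl = irrefl ; trans = Ω-trans
                     ; <-resp-≈ = (λ { refl p → p }) , (λ { refl p → p }) }
      maximum : (f : Fin n → ℕ) → ∃ λ N → ∀ j → f j ℕ.≤ N
      maximum = finite-upper-bound ℕ._≤_ ℕₚ.≤-trans 0
        (λ i j → i ℕ.⊔ j , ℕₚ.m≤m⊔n i j , ℕₚ.m≤n⊔m i j)
      from : ∀ j → Acc (flip Ω) j → ∃ λ N → ∀ m → N ℕ.≤ m → ¬ Chain m j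
      from j (acc rec) =
        let N , ≤N = maximum (proj₁ ∘ next)
        in ℕ.suc N , λ { (ℕ.suc m) (ℕ.s≤s N≤m) (i , r , ch) →
                         proj₂ (next i) m (ℕₚ.≤-trans (≤N i) N≤m) r ch }
        where
        next : ∀ i → ∃ λ N → ∀ m → N ℕ.≤ m → R j i → ¬ Chain m i
        next i with R? j i
        ... | yes r = let N , p = from i (rec (R⊆Ω r)) in N , λ m q _ → p m q
        ... | no ¬r = 0 , λ _ _ r → ⊥-elim (¬r r)

    module Solution {u : Vector C n} (S : System u) where
      open System S

      -- The heads of descending chains with `m` further members.
      Stage : ℕ → Pred (Vector A n) ℓ
      Stage ℕ.zero    b = Unit
      Stage (ℕ.suc m) b = ∃ λ c → Stage m c × c ⊴ b × Sat b c

      -- The next stage is nonempty below each open tuple above u because its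
      -- side values may be taken from the present one, whose infimum is
      -- closed and below u.
      stage-approximates : ∀ m → Approximates u (Stage m)
      stage-approximates ℕ.zero = record
        { directed = λ {b} {c} _ _ → meets b c , _ , (λ x → meet-lb₁ (sg x)) , (λ x → meet-lb₂ (sg x))
        ; below    = λ {o} _ → bots , _ , bots≪ {o} }
      stage-approximates (ℕ.suc m) = record
        { directed = λ {b} {b′} (c , Bc , c⊴b , sat) (c′ , Bc′ , c′⊴b′ , sat′) →
            let d , Bd , d⊴c , d⊴c′ = Approximates.directed (stage-approximates m) Bc Bc′
            in meets b b′
             , (d , Bd
                  , (λ x → meet-greatest (sg x) (⊑-trans (d⊴c x) (c⊴b x)) (⊑-trans (d⊴c′ x) (c′⊴b′ x)))
                  -- The meet is covered only by `b` and `b′` together, and this is allowed since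
                  -- `d` is also below `c′`.
                  , mix sat sat′ d⊴c (λ i → inj₂ (⊑-refl (sg i) , λ j _ → d⊴c′ j)))
             , (λ x → meet-lb₁ (sg x)) , (λ x → meet-lb₂ (sg x))
        ; below = λ {o} open-o →
            let b , c , b≪o , Bc , sat = approx open-o (stage-approximates m)
                c₀ , Bc₀ , c₀≪o = Approximates.below (stage-approximates m) open-o
                d , Bd , d⊴c₀ , d⊴c = Approximates.directed (stage-approximates m) Bc₀ Bc
            in joins b c₀
             , (d , Bd , (λ x → ⊑-trans (d⊴c₀ x) (join-ub₂ (sg x)))
                  , sat-mono sat (λ x → join-ub₁ (sg x)) d⊴c)
             , joins≪ {o = o} b≪o c₀≪o
        }

      -- From a chain e₀ ⊵ e₁ ⊵ … with Sat eₘ eₘ₊₁ a single tuple is read off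
      -- diagonally: its x-th coordinate comes from e₁₊ₘ for the largest m such
      -- that an R-chain of length m starts at x.  Here e = e₁₊ₘ, and b and c are
      -- the approximations to that tuple before and after taking e into account.
      diagonal : ∀ {N} → (∀ j → ¬ Chain N j) → ∀ fuel m → fuel ℕ.+ m ≡ N → ∀ {b c e} →
                 Stage fuel e → Sat b c → e ⊴ c →
                 (∀ i → (Chain m i × c i ≡ e i) ⊎ (¬ Chain m i × c i ≡ b i)) → ∃ λ a → Sat a a
      diagonal none ℕ.zero m refl {b} {c} _ sat e⊴c status =
        c , sat-mono sat (λ i → unchanged i (status i)) (λ i → ⊑-refl (sg i))
        where
        unchanged : ∀ i → _ → b i ⊑⟨ sg i ⟩ c i
        unchanged i (inj₁ (ch , _)) = ⊥-elim (none i ch)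
        unchanged i (inj₂ (_ , eq)) = ⊑-reflexive (sg i) (sym eq)
      diagonal none (ℕ.suc fuel) m eq {b} {c} {e} (e′ , stage , e′⊴e , sat′) sat e⊴c status =
        diagonal none fuel (ℕ.suc m) (trans (ℕₚ.+-suc fuel m) eq) {c} {c″} {e′} stage
          -- The former `c` becomes the critical tuple. A coordinate that it shares with `b` is
          -- covered by `b`; one that it took from `e` is covered by `e`, and the side variables
          -- below that coordinate have just moved to `e′`.
          (mix sat sat′ c″⊴c mixed) e′⊴c″ status″
        where
        select : ∀ {i} → Dec (Chain (ℕ.suc m) i) → A
        select {i} (yes _) = e′ i
        select {i} (no _)  = c i
        c″ : Vector A n
        c″ i = select (chain? (ℕ.suc m) i)
        e′⊴c : e′ ⊴ c
        e′⊴c i = ⊑-trans (e′⊴e i) (e⊴c i)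
        c″⊴c : c″ ⊴ c
        c″⊴c i with chain? (ℕ.suc m) i
        ... | yes _ = e′⊴c i
        ... | no _  = ⊑-refl (sg i)
        e′⊴c″ : e′ ⊴ c″
        e′⊴c″ i with chain? (ℕ.suc m) i
        ... | yes _ = ⊑-refl (sg i)
        ... | no _  = e′⊴c i
        status″ : ∀ i → (Chain (ℕ.suc m) i × c″ i ≡ e′ i) ⊎ (¬ Chain (ℕ.suc m) i × c″ i ≡ c i)
        status″ i with chain? (ℕ.suc m) i
        ... | yes ch = inj₁ (ch , refl)
        ... | no ¬ch = inj₂ (¬ch , refl)
        mixed : ∀ i → Mixed b c e e′ c c″ i
        mixed i with status i
        ... | inj₂ (_ , ci≡bi)  = inj₁ (⊑-reflexive (sg i) (sym ci≡bi))
        ... | inj₁ (ch , ci≡ei) = inj₂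
          ( ⊑-trans (meet-lb₂ (sg i)) (⊑-reflexive (sg i) (sym ci≡ei))
          , λ j r → selected j (i , r , ch) )
          where
          selected : ∀ j → Chain (ℕ.suc m) j → c″ j ⊑⟨ sg j ⟩ e′ j
          selected j ch with chain? (ℕ.suc m) j
          ... | yes _  = ⊑-refl (sg j)
          ... | no ¬ch = ⊥-elim (¬ch ch)

      solution : (∃ λ N → ∀ j → ¬ Chain N j) → ∃ λ a → Sat a a
      solution (N , none) =
        -- One stage beyond `N` supplies the starting pair, the other `N` supply the rounds. Every
        -- variable starts a chain of length zero, so at first all coordinates come from `e`.
        let _ , e , stage , _ , sat = approximates-nonempty (stage-approximates (ℕ.suc N))
        in diagonal none N 0 (ℕₚ.+-identityʳ N) stage sat (λ i → ⊑-refl (sg i))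
             (λ i → inj₁ (_ , refl))

  -- Approximating the value of an inductive term by systems

  module _ {u : Vector C n} where

    -- Carries an approximation of the value at `u` back to `A`, where `κ` can be tested at any
    -- solution of the system.
    Supported : Sign → Term 𝒮 n → C → Set (lsuc ℓ)
    Supported s t κ = ∃ λ (S : System u) → ∀ a → System.Sat S a a →
                      κ ≤⟨ s ⟩ ι (evalᴬ t λ x _ → a x)

    evalPair-diagonal : ∀ s t a → evalPair s t a a ⊑⟨ s ⟩ evalᴬ t (λ x _ → a x)
    evalPair-diagonal s t a = evalᴬ-mono s t λ x br → go (leafSign s br) x
      where
      go : ∀ r x → pair a a r x ⊑⟨ r ⟩ a x
      go r x with critical? {𝒮 = 𝒮} ε r x
      ... | yes _ = ⊑-refl r
      ... | no _  = ⊑-refl r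

    SupportedBelow : Sign → Term 𝒮 n → Set (lsuc ℓ)
    SupportedBelow s t = ∀ {X} → (∀ κ → Supported s t κ → κ ≤⟨ s ⟩ X) →
                         evalᶜ t (λ x _ → u x) ≤⟨ s ⟩ X

    PIA-supported : ∀ s t → PIA {R = R} ε s t → SupportedBelow s t
    PIA-supported s t pia hyp = dense s λ k kc k≤t → hyp k
      ( constraintSystem pia kc k≤t
      , λ a sat → ≤⟨⟩-trans sat (ι-mono s (evalPair-diagonal s t a)) )

    -- The joins approximating the arguments are pulled out of the node. By `bounded`, the operation
    -- applied to supported elements is supported by the product of their systems.
    node-supported : ∀ s c args → Additivity s c →
                     (∀ h → SupportedBelow (childSign s c h) (args h)) → SupportedBelow s (node c args)
    node-supported s c args add supported hyp = complete-join (op c) s (additive add)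
      (λ h → Supported (childSign s c h) (args h))
      -- Bottom is supported by the empty system, which makes each family nonempty, as
      -- `complete-join` demands.
      (λ h → ι (bot (childSign s c h)) , trivialSystem , λ _ _ → ι-bot-least (childSign s c h))
      (λ h X → supported h)
      (λ κ supp → hyp (applyᶜ c κ)
        ( productSystem (λ h → proj₁ (supp h))
        , λ a sat → bounded (op c) s (λ h → proj₂ (supp h) a (sat h)) ))

    -- `∧̂` and `∨̂` are Skeleton nodes for both signs and are always decomposed. At the first node
    -- that is not Skeleton, a good branch has no Skeleton part left, so every critical branch there
    -- consists of PIA nodes.
    inductive-supported : ∀ s t → InductiveTree R ε s t → SupportedBelow s t

    private
      skeleton : ∀ s c args → Additivity s c → InductiveTree R ε s (node c args) →
                 SupportedBelow s (node c args)
      skeleton s c args add ind = node-supported s c args add λ h →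
        inductive-supported _ (args h) λ b crit →
          let good , srr = ind (step h b) crit in tailGood good , proj₂ srr
        where
        tailGood : ∀ {y ys} →
          (∃₂ λ P₂ P₁ → y ∷ ys ≡ P₂ ++ P₁ × All SkeletonNode P₂ × All PIANode P₁) →
          ∃₂ λ P₂ P₁ → ys ≡ P₂ ++ P₁ × All SkeletonNode P₂ × All PIANode P₁
        tailGood ([] , _ ∷ P₁ , refl , [] , _ ∷ ps) = [] , P₁ , refl , [] , ps
        tailGood (_ ∷ P₂ , P₁ , refl , _ ∷ qs , ps) = P₂ , P₁ , refl , qs , ps

      notSkeleton : ∀ s c args → ¬ SkeletonNode (s , c) → InductiveTree R ε s (node c args) →
                    SupportedBelow s (node c args)
      notSkeleton s c args ¬skel ind = PIA-supported s (node c args) (toPIA ε s (node c args)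
        λ { b@(step _ _) crit → let good , srr = ind b crit in allPIA good , srr })
        where
        allPIA : ∀ {xs} → (∃₂ λ P₂ P₁ → (s , c) ∷ xs ≡ P₂ ++ P₁ × All SkeletonNode P₂ ×
                                         All PIANode P₁) →
                 All PIANode ((s , c) ∷ xs)
        allPIA ([]      , P₁ , refl , _ , ps)       = ps
        allPIA ((_ ∷ _) , P₁ , refl , (q ∷ _) , _) = ⊥-elim (¬skel q)

    inductive-supported s (var x) ind = PIA-supported s (var x)
      (toPIA ε s (var x) λ { leaf crit → [] , proj₂ (ind leaf crit) })
    inductive-supported s (node ⊥̂ args) ind = PIA-supported s (node ⊥̂ args)
      (noncritical λ { _ (step () _) _ })
    inductive-supported s (node ⊤̂ args) ind = PIA-supported s (node ⊤̂ args)
      (noncritical λ { _ (step () _) _ })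
    inductive-supported s (node ∧̂ args) ind = skeleton s ∧̂ args ∧-additive ind
    inductive-supported s (node ∨̂ args) ind = skeleton s ∨̂ args ∨-additive ind
    inductive-supported ⊕ (node (𝕗 f) args) ind = skeleton ⊕ (𝕗 f) args f-additive ind
    inductive-supported ⊖ (node (𝕗 f) args) ind =
      notSkeleton ⊖ (𝕗 f) args (λ { (inj₁ ()) ; (inj₂ ()) }) ind
    inductive-supported ⊕ (node (𝕘 g) args) ind =
      notSkeleton ⊕ (𝕘 g) args (λ { (inj₁ ()) ; (inj₂ ()) }) ind
    inductive-supported ⊖ (node (𝕘 g) args) ind = skeleton ⊖ (𝕘 g) args g-additive ind

-- Canonicity of inductive inequalities

inductive-canonical : ∀ {ℓ} {L : BDL ℓ} (E : CanonicalExtension L) {o} {𝒮 : Signature o}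
  (I : Interpretation E 𝒮) {n} (s t : Term 𝒮 n) → Inductive s t →
  let open Canonical E ; open Evaluation E I in
  (∀ (a : Vector A n) → evalᴬ s (λ x _ → a x) ⊑⟨ ⊕ ⟩ evalᴬ t (λ x _ → a x)) →
  ∀ (u : Vector C n) → evalᶜ s (λ x _ → u x) ≤⟨ ⊕ ⟩ evalᶜ t (λ x _ → u x)
inductive-canonical E {𝒮 = 𝒮} I {n} s t (Ω , ε , irrefl , Ω-trans , ind-s , ind-t) valid u =
  inductive-supported ⊕ s (inductive-restrict ind-s λ d → fromWitness (inj₁ d)) λ κ (S , κ≤s) →
  turn ⊖ (inductive-supported ⊖ t (inductive-restrict ind-t λ d → fromWitness (inj₂ d)) λ κ′ (S′ , t≤κ′) →
    -- A common solution of both systems compares `κ` with `κ′` through the inequality that is valid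
    -- at `a`.
    turn ⊕ (let a , sat = Solution.solution R? (productSystem {m = 2} λ { 0F → S ; 1F → S′ })
                            (chains-bounded R? R⊆Ω irrefl Ω-trans)
            in ≤⟨⟩-trans (κ≤s a (sat 0F))
                 (≤⟨⟩-trans (ι-mono ⊕ (valid a)) (turn ⊖ (t≤κ′ a (sat 1F))))))
  where
  open Canonical E
  dependent? : ∀ k x → Dec (Depends ε ⊕ s k x ⊎ Depends ε ⊖ t k x)
  dependent? k x = depends? ε ⊕ s k x ⊎-dec depends? ε ⊖ t k x
  -- Ω itself need not be decidable; reading off the diagonal needs decisions.
  R : Rel (Fin n) 0ℓ
  R k x = True (dependent? k x)
  R? : ∀ k x → Dec (R k x)
  R? k x = T? _
  R⊆Ω : ∀ {k x} → R k x → Ω k x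
  R⊆Ω r with toWitness r
  ... | inj₁ d = depends-Ω ind-s d
  ... | inj₂ d = depends-Ω ind-t d
  open ConstraintSystems E I ε R

theorem44 : ∀ {o ℓ} {𝒮 : Signature o} (π σ lam ρ : Term 𝒮 1) →
    PositiveIn 0F π → PositiveIn 0F σ → NegativeIn 0F lam → NegativeIn 0F ρ →
    (A : DLE 𝒮 ℓ) →
    let p = var {𝒮 = 𝒮} {n = 2} 0F
        q = var {𝒮 = 𝒮} {n = 2} 1F
        𝔸 = DLE.algebra A in
    𝔸 ⊨ π [ p ∨ᵗ q ] ≼ π [ p ] ∨ᵗ π [ q ] →
    𝔸 ⊨ σ [ p ] ∧ᵗ σ [ q ] ≼ σ [ p ∧ᵗ q ] →
    𝔸 ⊨ ρ [ p ] ∧ᵗ ρ [ q ] ≼ ρ [ p ∨ᵗ q ] →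
    𝔸 ⊨ lam [ p ∧ᵗ q ] ≼ lam [ p ] ∨ᵗ lam [ q ] →
    ∀ {n : ℕ} (φ ψ : Term 𝒮 n) → MetaInductive π σ lam ρ φ ψ →
    (Aδ : CanonicalExtension (DLE.bdl A)) →
    𝔸 ⊨ φ ≼ ψ → canonicalExtension A Aδ ⊨ φ ≼ ψ
theorem44 π σ lam ρ π⁺ σ⁺ λ⁻ ρ⁻ A π-∨ σ-∧ ρ-∨ λ-∧ _ _ (meta {s} {t} ind) Aδ valid u =
  le (≤⟨⟩-trans (≈⇒≤⟨⟩ ⊕ (valueᶜ s u))
     (≤⟨⟩-trans (inductive-canonical Aδ I s t ind
                  (λ a → ⊑-trans (≈⇒⊑ ⊕ (A.Eq.sym (valueᴬ s a)))
                           (⊑-trans ⟪ valid a ⟫ (≈⇒⊑ ⊕ (valueᴬ t a)))) u)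
                (≈⇒≤⟨⟩ ⊕ (Aδ.Eq.sym (valueᶜ t u)))))
  where
  module A  = DLE A
  module Aδ = CanonicalExtension Aδ
  open Canonical Aδ hiding (A)
  open Evaluation Aδ (canonical A Aδ)
  I = canonical⋆ A Aδ π σ lam ρ π⁺ σ⁺ λ⁻ ρ⁻ π-∨ σ-∧ ρ-∨ λ-∧
  valueᴬ = eval-replace A.algebra applyᴬ-cong π σ lam ρ
  valueᶜ = eval-replace (canonicalExtension A Aδ) applyᶜ-cong π σ lam ρ
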